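{- There is a non-adaptive randomized algorithm that, given a parameter $\varepsilon>0$ and access through degree queries $\mathtt{Deg}$ and random edge queries $\mathtt{RandEdge}$ to a simple undirected graph $G=(V,E)$ (possibly with isolated vertices) with $|V|=n$, $|E|=m$ and $m\ge n/2$, outputs an estimate $\widetilde m$ that, with probability at least $3/4$, satisfies $$(1-\varepsilon)m\le \widetilde m\le (1+\varepsilon)m,$$ and that uses $\widetilde O\bigl(n^{1/2}\varepsilon^{ -2.5}\bigr)$ queries.
   Context: The vertex set $V$ (hence $n$) is known to the algorithm, while $E$ is unknown and accessed only through queries. A degree query $\mathtt{Deg}(v)$, for $v\in V$, returns the degree $\deg(v)$ of $v$. A random edge query $\mathtt{RandEdge}$ returns an edge chosen uniformly at random from $E$, independently of other queries. A randomized algorithm is non-adaptive if it determines all its queries in advance, based solely on its input parameters and its internal randomness, without depending on the answers to previous queries. The notation $\widetilde O(\cdot)$ suppresses factors polynomial in $\log n$ and $1/\varepsilon$. -}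

module Defs where

open import Data.Fin.Base as Fin using (Fin)
import Data.Fin.Properties as Fin
open import Data.Integer.Base as ℤ using (+_)
open import Data.List.Base
  using (List; []; _∷_; [_]; length; filter; allFin; cartesianProduct; cartesianProductWith)
open import Data.Nat.Base as ℕ using (ℕ; zero; suc)
open import Data.Nat.Logarithm using (⌈log₂_⌉)
open import Data.Product.Base using (_×_; _,_; ∃-syntax)
open import Data.Rational.Base as ℚ
  using (ℚ; 0ℚ; 1ℚ; _/_; _≤_; _+_; _-_; _*_; 1/_; Positive; ceiling)
open import Data.Rational.Properties using (pos⇒nonZero; _≤?_)
open import Data.Vec.Base as Vec using (Vec)
open import Algebra.Definitions.RawSemiring ℚ.+-*-rawSemiring using (_^_)
open import Relation.Binary.Core using (Rel)
open import Relation.Binary.Definitions using (Decidable; Symmetric; Irreflexive)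
open import Relation.Binary.PropositionalEquality.Core using (_≡_)
open import Relation.Nullary.Decidable using (_×-dec_)
import Relation.Unary as U
open import Level using (0ℓ)

fromℕ : ℕ → ℚ
fromℕ k = + k / 1

recip : (ε : ℚ) → .{{Positive ε}} → ℚ
recip ε = (1/ ε) {{pos⇒nonZero ε}}

------------------------------------------------------------------------
-- Graphs

record Graph (n : ℕ) : Set₁ where
  field
    Adj    : Rel (Fin n) 0ℓ
    adj?   : Decidable Adj
    sym    : Symmetric Adj
    irrefl : Irreflexive _≡_ Adj

-- An edge {u, v} is represented by the pair (u , v) with u < v, so that
-- it occurs exactly once in the list of edges.
Edge : ℕ → Set
Edge n = Fin n × Fin n

module _ {n : ℕ} (G : Graph n) where
  open Graph G

  degree : Fin n → ℕ
  degree v = length (filter (adj? v) (allFin n))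

  edges : List (Edge n)
  edges = filter (λ (u , v) → (u Fin.<? v) ×-dec adj? u v)
                 (cartesianProduct (allFin n) (allFin n))

  ∣E∣ : ℕ
  ∣E∣ = length edges

------------------------------------------------------------------------
-- Finite uniform probability spaces, given by their list of outcomes

-- An empty list carries no distribution; its probabilities are set to 0,
-- so that a positive lower bound on Pr is never vacuously true.
Pr : {A : Set} {P : A → Set} → List A → U.Decidable P → ℚ
Pr []           P? = 0ℚ
Pr xs@(_ ∷ ys)  P? = + length (filter P? xs) / suc (length ys)

-- The outcomes of q independent uniform draws from a list.
draws : {A : Set} → List A → (q : ℕ) → List (Vec A q)
draws xs zero    = [ Vec.[] ]
draws xs (suc q) = cartesianProductWith Vec._∷_ xs (draws xs q)

------------------------------------------------------------------------
-- Non-adaptive randomized query algorithms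

data Query (n : ℕ) : Set where
  Deg      : Fin n → Query n
  RandEdge : Query n

Answer : {n : ℕ} → Query n → Set
Answer     (Deg v)  = ℕ
Answer {n} RandEdge = Edge n

-- The edge argument is the outcome of a uniform draw from the edges of G,
-- which a degree query ignores.
respond : {n : ℕ} → Graph n → Edge n → (x : Query n) → Answer x
respond G e (Deg v)  = degree G v
respond G e RandEdge = e

-- The internal randomness is a uniform element of Fin seeds.  Queries are
-- a function of it alone; only the final estimate depends on the answers.
record NonAdaptive (n : ℕ) : Set where
  field
    seeds             : ℕ
    {{seeds-nonZero}} : ℕ.NonZero seeds
    queryCount        : ℕ
    query             : Fin seeds → Fin queryCount → Query n
    estimate          : (ω : Fin seeds) →
                        ((i : Fin queryCount) → Answer (query ω i)) → ℚ

-- The algorithm is given n and ε, and nothing else, as input.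
Algorithm : Set
Algorithm = (n : ℕ) (ε : ℚ) → .{{Positive ε}} → NonAdaptive n

module _ {n : ℕ} (A : NonAdaptive n) (G : Graph n) where
  open NonAdaptive A

  Outcome : Set
  Outcome = Fin seeds × Vec (Edge n) queryCount

  -- The i-th drawn edge is reserved for the i-th query, so answers to
  -- distinct RandEdge queries are independent of each other and of ω.
  outcomes : List Outcome
  outcomes = cartesianProduct (allFin seeds) (draws (edges G) queryCount)

  output : Outcome → ℚ
  output (ω , es) = estimate ω λ i → respond G (Vec.lookup es i) (query ω i)

Approximates : ℚ → ℕ → ℚ → Set
Approximates ε m m̃ = (1ℚ - ε) * fromℕ m ≤ m̃ × m̃ ≤ (1ℚ + ε) * fromℕ m

approximates? : ∀ ε m → U.Decidable (Approximates ε m)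
approximates? ε m m̃ =
  ((1ℚ - ε) * fromℕ m ≤? m̃) ×-dec (m̃ ≤? (1ℚ + ε) * fromℕ m)

successProbability : {n : ℕ} → NonAdaptive n → Graph n → ℚ → ℚ
successProbability A G ε =
  Pr (outcomes A G) λ x → approximates? ε (∣E∣ G) (output A G x)

------------------------------------------------------------------------
-- Asymptotics

-- (1 + log n) (1 + log (1/ε)), with logarithms rounded up.
logFactor : (n : ℕ) (ε : ℚ) → .{{Positive ε}} → ℕ
logFactor n ε = suc ⌈log₂ n ⌉ ℕ.* suc ⌈log₂ ℤ.∣ ceiling (recip ε) ∣ ⌉

-- Since ℚ has no square roots, f ∈ Õ(√g) is expressed by squaring both
-- sides of  f ≤ C · logFactor ^ k · √g.
_∈Õ√_ : (f : (n : ℕ) (ε : ℚ) → .{{Positive ε}} → ℕ) →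
        (g : (n : ℕ) (ε : ℚ) → .{{Positive ε}} → ℚ) → Set
f ∈Õ√ g = ∃[ C ] ∃[ k ] ∀ n ε .{{_ : Positive ε}} →
  fromℕ (f n ε) ^ 2 ≤ fromℕ (C ℕ.* logFactor n ε ℕ.^ k) ^ 2 * g n ε

{-# OPTIONS --safe #-}
module Submission where

-- Cut V into s ≈ 256 √n blocks of b ≈ √n / 256 vertices, query the degree of one random vertex in each,
-- and let D be the sum of these degrees.  If h(e) is the number of queried endpoints of an edge e, then
-- h ≤ 2 and the sum of h over E is D, so for q random edges the number H of hits has mean q D / m
-- and the estimate is q D / H.  By Chebyshev it is accurate once q D ≥ 64 m / ε², for which
-- q ≈ 256 b / ε² suffices as soon as D ≥ m / (4 b).
-- That lower bound on D is again Chebyshev's inequality, applied only to light vertices (of degree at most ≈ 4 m / √n):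
-- there are so few heavy ones that at most half of the edges join two of them.
-- Probabilities are counts of outcomes and squares (L F − M)² are expanded in ℕ, with the cross term
-- moved to the other side.

open import Defs
open import Data.Rational.Base as ℚ
  using (ℚ; mkℚ; 0ℚ; 1ℚ; _/_; Positive; NonNegative; _≤_; _+_; _*_; _-_; toℚᵘ)
open import Algebra.Definitions.RawSemiring ℚ.+-*-rawSemiring using (_^_)
open import Data.Fin.Base as Fin using (Fin)
import Data.Fin.Properties as Fin
open import Data.Integer.Base as ℤ using (+_; +[1+_]; -[1+_])
import Data.Integer.Properties as ℤ
open import Data.List.Base
  using (List; []; _∷_; _++_; length; map; filter; allFin; tabulate; lookup; cartesianProduct; cartesianProductWith)
open import Data.List.Properties using (length-tabulate; tabulate-lookup)
open import Data.Maybe.Base using (Maybe; just; nothing; maybe′)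
open import Data.Nat.Base as ℕ using (ℕ; zero; suc; z≤n; s≤s)
  renaming (_+_ to _+ₙ_; _*_ to _*ₙ_; _≤_ to _≤ₙ_; _<_ to _<ₙ_)
import Data.Nat.DivMod as ℕ
import Data.Nat.Properties as ℕ
open import Data.Nat.Tactic.RingSolver using (solve-∀)
open import Data.Product.Base using (_×_; _,_; ∃-syntax; Σ-syntax; proj₁; proj₂)
import Data.Rational.Properties as ℚ
import Data.Rational.Solver as ℚ-Solver
open import Data.Rational.Unnormalised.Base as ℚᵘ using (mkℚᵘ; *≤*)
import Data.Rational.Unnormalised.Properties as ℚᵘ
open import Data.Sum.Base using (_⊎_; inj₁; inj₂; [_,_]′)
open import Data.Unit.Base using (⊤)
open import Data.Vec.Base as Vec using (Vec)
open import Function.Base using (_∘_; id; const)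
open import Relation.Binary.Definitions using (tri<; tri≈; tri>)
open import Relation.Binary.PropositionalEquality
open import Relation.Nullary
open import Relation.Nullary.Decidable using (_×-dec_)
open import Relation.Unary using (Decidable)

-- Without adaptivity `q` has to be fixed before `D` is known, so only a lower bound on `D` is
-- sought; a larger `D` just gives more hits and a sharper estimate. `D` need not be close to its
-- own mean: in a large star, missing the centre loses half of the degree sum. This is why the lower
-- bound is proved for light vertices alone. The blocks serve two ends. Their samples are
-- independent, so variances add; and no vertex can be sampled twice, which is what gives `h ≤ 2`.
-- Sampling with repetition would allow one edge to be hit many times by the same endpoint. Failure
-- is split evenly: probability at most 1/8 that `D` is too small and at most 1/8 that the hit count
-- deviates.

private variable
  A B C : Set
  P : A → Set

-- Finite sums

∑ : List A → (A → ℕ) → ℕ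
∑ []       f = 0
∑ (x ∷ xs) f = f x +ₙ ∑ xs f

∑-cong : {f g : A → ℕ} → f ≗ g → (xs : List A) → ∑ xs f ≡ ∑ xs g
∑-cong f≗g []       = refl
∑-cong f≗g (x ∷ xs) = cong₂ _+ₙ_ (f≗g x) (∑-cong f≗g xs)

∑-mono : {f g : A → ℕ} → (∀ x → f x ≤ₙ g x) → (xs : List A) → ∑ xs f ≤ₙ ∑ xs g
∑-mono f≤g []       = z≤n
∑-mono f≤g (x ∷ xs) = ℕ.+-mono-≤ (f≤g x) (∑-mono f≤g xs)

∑-map : (g : A → B) (f : B → ℕ) (xs : List A) → ∑ (map g xs) f ≡ ∑ xs (f ∘ g)
∑-map g f []       = refl
∑-map g f (x ∷ xs) = cong (f (g x) +ₙ_) (∑-map g f xs)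

∑-++ : (f : A → ℕ) (xs ys : List A) → ∑ (xs ++ ys) f ≡ ∑ xs f +ₙ ∑ ys f
∑-++ f []       ys = refl
∑-++ f (x ∷ xs) ys = trans (cong (f x +ₙ_) (∑-++ f xs ys)) (sym (ℕ.+-assoc (f x) _ _))

∑-distrib-+ : (f g : A → ℕ) (xs : List A) → ∑ xs (λ x → f x +ₙ g x) ≡ ∑ xs f +ₙ ∑ xs g
∑-distrib-+ f g []       = refl
∑-distrib-+ f g (x ∷ xs) rewrite ∑-distrib-+ f g xs = interchange (f x) (g x) (∑ xs f) (∑ xs g)
  where
  interchange : ∀ a b c d → a +ₙ b +ₙ (c +ₙ d) ≡ a +ₙ c +ₙ (b +ₙ d)
  interchange = solve-∀

∑-distribˡ-* : (c : ℕ) (f : A → ℕ) (xs : List A) → ∑ xs (λ x → c *ₙ f x) ≡ c *ₙ ∑ xs f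
∑-distribˡ-* c f []       = sym (ℕ.*-zeroʳ c)
∑-distribˡ-* c f (x ∷ xs) rewrite ∑-distribˡ-* c f xs = sym (ℕ.*-distribˡ-+ c (f x) (∑ xs f))

∑-const : (c : ℕ) (xs : List A) → ∑ xs (λ _ → c) ≡ length xs *ₙ c
∑-const c []       = refl
∑-const c (x ∷ xs) = cong (c +ₙ_) (∑-const c xs)

∑-swap : (f : A → B → ℕ) (xs : List A) (ys : List B) →
         ∑ xs (λ x → ∑ ys (f x)) ≡ ∑ ys (λ y → ∑ xs (λ x → f x y))
∑-swap f []       ys = sym (trans (∑-const 0 ys) (ℕ.*-zeroʳ (length ys)))
∑-swap f (x ∷ xs) ys = trans (cong (∑ ys (f x) +ₙ_) (∑-swap f xs ys)) (sym (∑-distrib-+ _ _ ys))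

∑-cartesianProductWith : (g : A → B → C) (f : C → ℕ) (xs : List A) (ys : List B) →
  ∑ (cartesianProductWith g xs ys) f ≡ ∑ xs (λ x → ∑ ys (λ y → f (g x y)))
∑-cartesianProductWith g f []       ys = refl
∑-cartesianProductWith g f (x ∷ xs) ys =
  trans (∑-++ f (map (g x) ys) _)
        (cong₂ _+ₙ_ (∑-map (g x) f ys) (∑-cartesianProductWith g f xs ys))

length≡∑1 : (xs : List A) → length xs ≡ ∑ xs (λ _ → 1)
length≡∑1 xs = sym (trans (∑-const 1 xs) (ℕ.*-identityʳ _))

length-cartesianProductWith : (g : A → B → C) (xs : List A) (ys : List B) →
  length (cartesianProductWith g xs ys) ≡ length xs *ₙ length ys
length-cartesianProductWith g xs ys = begin
  length (cartesianProductWith g xs ys)         ≡⟨ length≡∑1 (cartesianProductWith g xs ys) ⟩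
  ∑ (cartesianProductWith g xs ys) (λ _ → 1)    ≡⟨ ∑-cartesianProductWith g _ xs ys ⟩
  ∑ xs (λ _ → ∑ ys (λ _ → 1))                   ≡⟨ ∑-const _ xs ⟩
  length xs *ₙ ∑ ys (λ _ → 1)                   ≡⟨ cong (length xs *ₙ_) (length≡∑1 ys) ⟨
  length xs *ₙ length ys                        ∎
  where open ≡-Reasoning

∑-tabulate : ∀ {n} (g : Fin n → A) (f : A → ℕ) → ∑ (tabulate g) f ≡ ∑ (allFin n) (f ∘ g)
∑-tabulate {n = zero}  g f = refl
∑-tabulate {n = suc n} g f = cong (f (g Fin.zero) +ₙ_)
  (trans (∑-tabulate (g ∘ Fin.suc) f) (sym (∑-tabulate Fin.suc (f ∘ g))))

∑-allFin-suc : ∀ {n} (f : Fin (suc n) → ℕ) →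
  ∑ (allFin (suc n)) f ≡ f Fin.zero +ₙ ∑ (allFin n) (f ∘ Fin.suc)
∑-allFin-suc f = cong (f Fin.zero +ₙ_) (∑-tabulate Fin.suc f)

∑-lookup : (xs : List A) (f : A → ℕ) → ∑ (allFin (length xs)) (f ∘ lookup xs) ≡ ∑ xs f
∑-lookup xs f = trans (sym (∑-tabulate (lookup xs) f)) (cong (λ ys → ∑ ys f) (tabulate-lookup xs))

∑-splitAt : ∀ m n (f : Fin (m +ₙ n) → ℕ) →
  ∑ (allFin (m +ₙ n)) f ≡ ∑ (allFin m) (f ∘ (Fin._↑ˡ n)) +ₙ ∑ (allFin n) (f ∘ (m Fin.↑ʳ_))
∑-splitAt zero    n f = refl
∑-splitAt (suc m) n f = begin
  ∑ (allFin (suc m +ₙ n)) f                            ≡⟨ ∑-allFin-suc f ⟩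
  f Fin.zero +ₙ ∑ (allFin (m +ₙ n)) (f ∘ Fin.suc)
    ≡⟨ cong (f Fin.zero +ₙ_) (∑-splitAt m n (f ∘ Fin.suc)) ⟩
  f Fin.zero +ₙ (left +ₙ right)                        ≡⟨ ℕ.+-assoc (f Fin.zero) left right ⟨
  f Fin.zero +ₙ left +ₙ right
    ≡⟨ cong (_+ₙ right) (∑-allFin-suc (f ∘ (Fin._↑ˡ n))) ⟨
  ∑ (allFin (suc m)) (f ∘ (Fin._↑ˡ n)) +ₙ right        ∎
  where
  open ≡-Reasoning
  left  = ∑ (allFin m) (f ∘ Fin.suc ∘ (Fin._↑ˡ n))
  right = ∑ (allFin n) (f ∘ (suc m Fin.↑ʳ_))

∑-combine : ∀ m n (f : Fin (m *ₙ n) → ℕ) →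
  ∑ (allFin (m *ₙ n)) f ≡ ∑ (allFin m) (λ i → ∑ (allFin n) (λ j → f (Fin.combine i j)))
∑-combine zero    n f = refl
∑-combine (suc m) n f = begin
  ∑ (allFin (n +ₙ m *ₙ n)) f   ≡⟨ ∑-splitAt n (m *ₙ n) f ⟩
  ∑ (allFin n) (f ∘ (Fin._↑ˡ (m *ₙ n))) +ₙ ∑ (allFin (m *ₙ n)) (f ∘ (n Fin.↑ʳ_))
    ≡⟨ cong (∑ (allFin n) (f ∘ (Fin._↑ˡ (m *ₙ n))) +ₙ_) (∑-combine m n (f ∘ (n Fin.↑ʳ_))) ⟩
  ∑ (allFin n) (f ∘ (Fin._↑ˡ (m *ₙ n))) +ₙ ∑ (allFin m) (λ i → ∑ (allFin n) (λ j → f (n Fin.↑ʳ Fin.combine i j)))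
    ≡⟨ ∑-allFin-suc {m} (λ i → ∑ (allFin n) (λ j → f (Fin.combine i j))) ⟨
  ∑ (allFin (suc m)) (λ i → ∑ (allFin n) (λ j → f (Fin.combine i j)))                ∎
  where open ≡-Reasoning

𝟙 : {X : Set} → Dec X → ℕ
𝟙 (yes _) = 1
𝟙 (no  _) = 0

𝟙≤1 : {X : Set} (d : Dec X) → 𝟙 d ≤ₙ 1
𝟙≤1 (yes _) = s≤s z≤n
𝟙≤1 (no  _) = z≤n

∑-filter : (P? : Decidable P) (f : A → ℕ) (xs : List A) →
  ∑ (filter P? xs) f ≡ ∑ xs (λ x → 𝟙 (P? x) *ₙ f x)
∑-filter P? f []       = refl
∑-filter P? f (x ∷ xs) with P? x
... | yes _ = cong₂ _+ₙ_ (sym (ℕ.+-identityʳ (f x))) (∑-filter P? f xs)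
... | no  _ = ∑-filter P? f xs

length-filter : (P? : Decidable P) (xs : List A) → length (filter P? xs) ≡ ∑ xs (𝟙 ∘ P?)
length-filter P? xs = begin
  length (filter P? xs)           ≡⟨ length≡∑1 (filter P? xs) ⟩
  ∑ (filter P? xs) (λ _ → 1)      ≡⟨ ∑-filter P? _ xs ⟩
  ∑ xs (λ x → 𝟙 (P? x) *ₙ 1)      ≡⟨ ∑-cong (λ x → ℕ.*-identityʳ _) xs ⟩
  ∑ xs (𝟙 ∘ P?)                   ∎
  where open ≡-Reasoning

∑-squares : (f : A → ℕ) (xs : List A) → ∑ xs (λ x → f x *ₙ f x) ≤ₙ ∑ xs f *ₙ ∑ xs f
∑-squares f []       = z≤n
∑-squares f (x ∷ xs) = begin
  f x *ₙ f x +ₙ ∑ xs (λ x → f x *ₙ f x)       ≤⟨ ℕ.+-monoʳ-≤ (f x *ₙ f x) (∑-squares f xs) ⟩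
  f x *ₙ f x +ₙ s *ₙ s                        ≤⟨ ℕ.m≤m+n _ (f x *ₙ s +ₙ f x *ₙ s) ⟩
  f x *ₙ f x +ₙ s *ₙ s +ₙ (f x *ₙ s +ₙ f x *ₙ s)  ≡⟨ square (f x) s ⟨
  (f x +ₙ s) *ₙ (f x +ₙ s)                    ∎
  where
  open ℕ.≤-Reasoning
  s = ∑ xs f
  square : ∀ a b → (a +ₙ b) *ₙ (a +ₙ b) ≡ a *ₙ a +ₙ b *ₙ b +ₙ (a *ₙ b +ₙ a *ₙ b)
  square = solve-∀

-- Moments of independent draws

total : ∀ {q} → (Fin q → A → ℕ) → Vec A q → ℕ
total {q = q} f v = ∑ (allFin q) (λ i → f i (Vec.lookup v i))

module _ (xs : List A) where

  -- `length xs` times the mean of `total f` under independent uniform draws.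
  mass : ∀ {q} → (Fin q → A → ℕ) → ℕ
  mass {q} f = ∑ (allFin q) (λ i → ∑ xs (f i))

  mass² : ∀ {q} → (Fin q → A → ℕ) → ℕ
  mass² {q} f = ∑ (allFin q) (λ i → ∑ xs (λ x → f i x *ₙ f i x))

  length-draws : ∀ q → length (draws xs (suc q)) ≡ length xs *ₙ length (draws xs q)
  length-draws q = length-cartesianProductWith Vec._∷_ xs (draws xs q)

  total-∷ : ∀ {q} (f : Fin (suc q) → A → ℕ) x v →
    total f (x Vec.∷ v) ≡ f Fin.zero x +ₙ total (f ∘ Fin.suc) v
  total-∷ f x v = ∑-allFin-suc (λ i → f i (Vec.lookup (x Vec.∷ v) i))

  first-moment : ∀ q (f : Fin q → A → ℕ) →
    length xs *ₙ ∑ (draws xs q) (total f) ≡ length (draws xs q) *ₙ mass f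
  first-moment zero    f = ℕ.*-zeroʳ (length xs)
  first-moment (suc q) f = begin
    L *ₙ ∑ (draws xs (suc q)) (total f)
      ≡⟨ cong (L *ₙ_) (∑-cartesianProductWith Vec._∷_ (total f) xs (draws xs q)) ⟩
    L *ₙ ∑ xs (λ x → ∑ (draws xs q) (λ v → total f (x Vec.∷ v)))
      ≡⟨ cong (L *ₙ_) (∑-cong (λ x → trans (∑-cong (total-∷ f x) (draws xs q)) (trans (∑-distrib-+ _ _ (draws xs q)) (cong (_+ₙ S) (∑-const (f₀ x) (draws xs q))))) xs) ⟩
    L *ₙ ∑ xs (λ x → D *ₙ f₀ x +ₙ S)
      ≡⟨ cong (L *ₙ_) (trans (∑-distrib-+ _ _ xs) (cong₂ _+ₙ_ (∑-distribˡ-* D f₀ xs) (∑-const S xs))) ⟩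
    L *ₙ (D *ₙ ∑ xs f₀ +ₙ L *ₙ S)
      ≡⟨ cong (λ z → L *ₙ (D *ₙ ∑ xs f₀ +ₙ z)) (first-moment q (f ∘ Fin.suc)) ⟩
    L *ₙ (D *ₙ ∑ xs f₀ +ₙ D *ₙ mass (f ∘ Fin.suc))
      ≡⟨ regroup L D (∑ xs f₀) (mass (f ∘ Fin.suc)) ⟩
    L *ₙ D *ₙ (∑ xs f₀ +ₙ mass (f ∘ Fin.suc))
      ≡⟨ cong₂ _*ₙ_ (length-draws q) (∑-allFin-suc (λ i → ∑ xs (f i))) ⟨
    length (draws xs (suc q)) *ₙ mass f ∎
    where
    open ≡-Reasoning
    L = length xs
    D = length (draws xs q)
    f₀ = f Fin.zero
    S = ∑ (draws xs q) (total (f ∘ Fin.suc))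
    regroup : ∀ L D m M → L *ₙ (D *ₙ m +ₙ D *ₙ M) ≡ L *ₙ D *ₙ (m +ₙ M)
    regroup = solve-∀

  -- By independence the variance of the total is the sum of the coordinate variances, which scaled
  -- by `L²` are `L ∑ f² − (∑ f)²`. Since `∑ f² ≤ (∑ f)²` for natural numbers, each is at most
  -- `a ∑ f²` with `a = L − 1`. The factor `a` in place of `L` makes the bound vanish for blocks of
  -- one vertex, which keeps small `n` within the threshold of `few-sparse`.
  second-moment : ∀ a → length xs ≡ suc a → ∀ q (f : Fin q → A → ℕ) →
    length xs *ₙ length xs *ₙ ∑ (draws xs q) (λ v → total f v *ₙ total f v)
      ≤ₙ length (draws xs q) *ₙ (mass f *ₙ mass f +ₙ a *ₙ mass² f)
  second-moment a len zero    f = ℕ.≤-trans (ℕ.≤-reflexive (ℕ.*-zeroʳ (length xs *ₙ length xs))) z≤n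
  second-moment a len (suc q) f = begin
    L *ₙ L *ₙ ∑ (draws xs (suc q)) (λ v → total f v *ₙ total f v)
      ≡⟨ cong (L *ₙ L *ₙ_) (∑-cartesianProductWith Vec._∷_ (λ v → total f v *ₙ total f v) xs (draws xs q)) ⟩
    L *ₙ L *ₙ ∑ xs (λ x → ∑ (draws xs q) (λ v → total f (x Vec.∷ v) *ₙ total f (x Vec.∷ v)))
      ≡⟨ cong (L *ₙ L *ₙ_) (∑-cong inner xs) ⟩
    L *ₙ L *ₙ ∑ xs (λ x → D *ₙ (f₀ x *ₙ f₀ x) +ₙ (2 *ₙ S₁ *ₙ f₀ x +ₙ S₂))
      ≡⟨ cong (L *ₙ L *ₙ_) outer ⟩
    L *ₙ L *ₙ (D *ₙ V₀ +ₙ (2 *ₙ S₁ *ₙ μ +ₙ L *ₙ S₂))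
      ≡⟨ expand L D V₀ μ S₁ S₂ ⟩
    L *ₙ L *ₙ D *ₙ V₀ +ₙ (2 *ₙ L *ₙ μ *ₙ (L *ₙ S₁) +ₙ L *ₙ (L *ₙ L *ₙ S₂))
      ≡⟨ cong (λ z → L *ₙ L *ₙ D *ₙ V₀ +ₙ (2 *ₙ L *ₙ μ *ₙ z +ₙ L *ₙ (L *ₙ L *ₙ S₂))) (first-moment q g) ⟩
    L *ₙ L *ₙ D *ₙ V₀ +ₙ (2 *ₙ L *ₙ μ *ₙ (D *ₙ M) +ₙ L *ₙ (L *ₙ L *ₙ S₂))
      ≤⟨ ℕ.+-monoʳ-≤ (L *ₙ L *ₙ D *ₙ V₀) (ℕ.+-monoʳ-≤ (2 *ₙ L *ₙ μ *ₙ (D *ₙ M)) (ℕ.*-monoʳ-≤ L (second-moment a len q g))) ⟩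
    L *ₙ L *ₙ D *ₙ V₀ +ₙ (2 *ₙ L *ₙ μ *ₙ (D *ₙ M) +ₙ L *ₙ (D *ₙ (M *ₙ M +ₙ a *ₙ V)))
      ≡⟨ factor L D V₀ μ M (a *ₙ V) ⟩
    L *ₙ D *ₙ (L *ₙ V₀ +ₙ (2 *ₙ μ *ₙ M +ₙ (M *ₙ M +ₙ a *ₙ V)))
      ≡⟨ cong (λ z → L *ₙ D *ₙ (z *ₙ V₀ +ₙ (2 *ₙ μ *ₙ M +ₙ (M *ₙ M +ₙ a *ₙ V)))) len ⟩
    L *ₙ D *ₙ (V₀ +ₙ a *ₙ V₀ +ₙ (2 *ₙ μ *ₙ M +ₙ (M *ₙ M +ₙ a *ₙ V)))
      -- One of the `a + 1` copies of `V₀` is traded for `μ²`, which completes the square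
      -- `(μ + M)²`.
      ≤⟨ ℕ.*-monoʳ-≤ (L *ₙ D) (ℕ.+-monoˡ-≤ _ (ℕ.+-monoˡ-≤ (a *ₙ V₀) (∑-squares f₀ xs))) ⟩
    L *ₙ D *ₙ (μ *ₙ μ +ₙ a *ₙ V₀ +ₙ (2 *ₙ μ *ₙ M +ₙ (M *ₙ M +ₙ a *ₙ V)))
      ≡⟨ cong (L *ₙ D *ₙ_) (complete a μ M V₀ V) ⟩
    L *ₙ D *ₙ ((μ +ₙ M) *ₙ (μ +ₙ M) +ₙ a *ₙ (V₀ +ₙ V))
      ≡⟨ cong₂ _*ₙ_ (length-draws q) (cong₂ (λ m v → m *ₙ m +ₙ a *ₙ v) (∑-allFin-suc (λ i → ∑ xs (f i))) (∑-allFin-suc (λ i → ∑ xs (λ x → f i x *ₙ f i x)))) ⟨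
    length (draws xs (suc q)) *ₙ (mass f *ₙ mass f +ₙ a *ₙ mass² f) ∎
    where
    open ℕ.≤-Reasoning
    L = length xs
    D = length (draws xs q)
    f₀ = f Fin.zero
    g = f ∘ Fin.suc
    S₁ = ∑ (draws xs q) (total g)
    S₂ = ∑ (draws xs q) (λ v → total g v *ₙ total g v)
    μ = ∑ xs f₀
    V₀ = ∑ xs (λ x → f₀ x *ₙ f₀ x)
    M = mass g
    V = mass² g
    square : ∀ a b → (a +ₙ b) *ₙ (a +ₙ b) ≡ a *ₙ a +ₙ (2 *ₙ a *ₙ b +ₙ b *ₙ b)
    square = solve-∀
    swap : ∀ a b → 2 *ₙ a *ₙ b ≡ 2 *ₙ b *ₙ a
    swap = solve-∀
    inner : ∀ x → ∑ (draws xs q) (λ v → total f (x Vec.∷ v) *ₙ total f (x Vec.∷ v))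
              ≡ D *ₙ (f₀ x *ₙ f₀ x) +ₙ (2 *ₙ S₁ *ₙ f₀ x +ₙ S₂)
    inner x = ≡.begin
      ∑ (draws xs q) (λ v → total f (x Vec.∷ v) *ₙ total f (x Vec.∷ v))
        ≡.≡⟨ ∑-cong (λ v → trans (cong (λ t → t *ₙ t) (total-∷ f x v)) (square (f₀ x) (total g v))) (draws xs q) ⟩
      ∑ (draws xs q) (λ v → f₀ x *ₙ f₀ x +ₙ (2 *ₙ f₀ x *ₙ total g v +ₙ total g v *ₙ total g v))
        ≡.≡⟨ trans (∑-distrib-+ _ _ (draws xs q)) (cong₂ _+ₙ_ (∑-const (f₀ x *ₙ f₀ x) (draws xs q)) (∑-distrib-+ _ _ (draws xs q))) ⟩
      D *ₙ (f₀ x *ₙ f₀ x) +ₙ (∑ (draws xs q) (λ v → 2 *ₙ f₀ x *ₙ total g v) +ₙ S₂)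
        ≡.≡⟨ cong (λ z → D *ₙ (f₀ x *ₙ f₀ x) +ₙ (z +ₙ S₂)) (trans (∑-distribˡ-* (2 *ₙ f₀ x) (total g) (draws xs q)) (swap (f₀ x) S₁)) ⟩
      D *ₙ (f₀ x *ₙ f₀ x) +ₙ (2 *ₙ S₁ *ₙ f₀ x +ₙ S₂) ≡.∎
      where module ≡ = ≡-Reasoning
    outer : ∑ xs (λ x → D *ₙ (f₀ x *ₙ f₀ x) +ₙ (2 *ₙ S₁ *ₙ f₀ x +ₙ S₂)) ≡ D *ₙ V₀ +ₙ (2 *ₙ S₁ *ₙ μ +ₙ L *ₙ S₂)
    outer = trans (∑-distrib-+ _ _ xs) (cong₂ _+ₙ_ (∑-distribˡ-* D _ xs)
            (trans (∑-distrib-+ _ _ xs) (cong₂ _+ₙ_ (∑-distribˡ-* (2 *ₙ S₁) f₀ xs) (∑-const S₂ xs))))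
    expand : ∀ L D V₀ μ S₁ S₂ → L *ₙ L *ₙ (D *ₙ V₀ +ₙ (2 *ₙ S₁ *ₙ μ +ₙ L *ₙ S₂))
      ≡ L *ₙ L *ₙ D *ₙ V₀ +ₙ (2 *ₙ L *ₙ μ *ₙ (L *ₙ S₁) +ₙ L *ₙ (L *ₙ L *ₙ S₂))
    expand = solve-∀
    factor : ∀ L D V₀ μ M V → L *ₙ L *ₙ D *ₙ V₀ +ₙ (2 *ₙ L *ₙ μ *ₙ (D *ₙ M) +ₙ L *ₙ (D *ₙ (M *ₙ M +ₙ V)))
      ≡ L *ₙ D *ₙ (L *ₙ V₀ +ₙ (2 *ₙ μ *ₙ M +ₙ (M *ₙ M +ₙ V)))
    factor = solve-∀
    complete : ∀ a μ M V₀ V → μ *ₙ μ +ₙ a *ₙ V₀ +ₙ (2 *ₙ μ *ₙ M +ₙ (M *ₙ M +ₙ a *ₙ V))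
      ≡ (μ +ₙ M) *ₙ (μ +ₙ M) +ₙ a *ₙ (V₀ +ₙ V)
    complete = solve-∀

-- Chebyshev's inequality

-- With the larger of `X` and `Y` written as the smaller plus `M + d`, the two sides differ by
-- `2 M d + d²`. The case `M = 0` is `am-gm`, which covers the outcomes outside the event in
-- `chebyshev`.
apart⇒square-gap : ∀ {M X Y} → X +ₙ M ≤ₙ Y ⊎ Y +ₙ M ≤ₙ X →
  M *ₙ M +ₙ 2 *ₙ X *ₙ Y ≤ₙ X *ₙ X +ₙ Y *ₙ Y
apart⇒square-gap {M} {X} (inj₁ X+M≤Y) with d , refl ← ℕ.m≤n⇒∃[o]m+o≡n X+M≤Y = begin
  M *ₙ M +ₙ 2 *ₙ X *ₙ (X +ₙ M +ₙ d)                             ≤⟨ ℕ.m≤m+n _ (2 *ₙ M *ₙ d +ₙ d *ₙ d) ⟩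
  M *ₙ M +ₙ 2 *ₙ X *ₙ (X +ₙ M +ₙ d) +ₙ (2 *ₙ M *ₙ d +ₙ d *ₙ d)  ≡⟨ gap M X d ⟩
  X *ₙ X +ₙ (X +ₙ M +ₙ d) *ₙ (X +ₙ M +ₙ d)                      ∎
  where
  open ℕ.≤-Reasoning
  gap : ∀ M X d → M *ₙ M +ₙ 2 *ₙ X *ₙ (X +ₙ M +ₙ d) +ₙ (2 *ₙ M *ₙ d +ₙ d *ₙ d)
                  ≡ X *ₙ X +ₙ (X +ₙ M +ₙ d) *ₙ (X +ₙ M +ₙ d)
  gap = solve-∀
apart⇒square-gap {M} {X} {Y} (inj₂ Y+M≤X) = begin
  M *ₙ M +ₙ 2 *ₙ X *ₙ Y  ≡⟨ cong (M *ₙ M +ₙ_) (swap X Y) ⟩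
  M *ₙ M +ₙ 2 *ₙ Y *ₙ X  ≤⟨ apart⇒square-gap {M} (inj₁ Y+M≤X) ⟩
  Y *ₙ Y +ₙ X *ₙ X       ≡⟨ ℕ.+-comm (Y *ₙ Y) _ ⟩
  X *ₙ X +ₙ Y *ₙ Y       ∎
  where
  open ℕ.≤-Reasoning
  swap : ∀ a b → 2 *ₙ a *ₙ b ≡ 2 *ₙ b *ₙ a
  swap = solve-∀

am-gm : ∀ X Y → 2 *ₙ X *ₙ Y ≤ₙ X *ₙ X +ₙ Y *ₙ Y
am-gm X Y = apart⇒square-gap {0} ([ (λ X≤Y → inj₁ (subst (_≤ₙ Y) (sym (ℕ.+-identityʳ X)) X≤Y))
                                  , (λ Y≤X → inj₂ (subst (_≤ₙ X) (sym (ℕ.+-identityʳ Y)) Y≤X)) ]′ (ℕ.≤-total X Y))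

-- The event says that K |L F − M| ≥ M, where F has mean M / L.
chebyshev : ∀ (xs : List A) a → length xs ≡ suc a → ∀ {q} (f : Fin q → A → ℕ) K
  {P : Vec A q → Set} (P? : Decidable P) →
  (∀ v → P v → K *ₙ (length xs *ₙ total f v) +ₙ mass xs f ≤ₙ K *ₙ mass xs f
             ⊎ K *ₙ mass xs f +ₙ mass xs f ≤ₙ K *ₙ (length xs *ₙ total f v)) →
  ∑ (draws xs q) (𝟙 ∘ P?) *ₙ (mass xs f *ₙ mass xs f)
    ≤ₙ K *ₙ K *ₙ (length (draws xs q) *ₙ (a *ₙ mass² xs f))
-- The term added on both sides is the cross term summed over all draws, which `first-moment`
-- evaluates; cancelling it leaves the variance.
chebyshev xs a len {q} f K P? apart = ℕ.+-cancelʳ-≤ (2 *ₙ K *ₙ K *ₙ D *ₙ M *ₙ M) _ _ (begin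
  c *ₙ (M *ₙ M) +ₙ 2 *ₙ K *ₙ K *ₙ D *ₙ M *ₙ M
    ≡⟨ regroup c (M *ₙ M) K D M ⟩
  M *ₙ M *ₙ c +ₙ 2 *ₙ K *ₙ K *ₙ M *ₙ (D *ₙ M)
    ≡⟨ cong (λ z → M *ₙ M *ₙ c +ₙ 2 *ₙ K *ₙ K *ₙ M *ₙ z) (first-moment xs q f) ⟨
  M *ₙ M *ₙ c +ₙ 2 *ₙ K *ₙ K *ₙ M *ₙ (L *ₙ S₁)
    ≡⟨ cong (M *ₙ M *ₙ c +ₙ_) (ℕ.*-assoc (2 *ₙ K *ₙ K *ₙ M) L S₁) ⟨
  M *ₙ M *ₙ c +ₙ 2 *ₙ K *ₙ K *ₙ M *ₙ L *ₙ S₁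
    ≡⟨ trans (∑-distrib-+ _ _ Ω) (cong₂ _+ₙ_ (∑-distribˡ-* (M *ₙ M) _ Ω) (∑-distribˡ-* (2 *ₙ K *ₙ K *ₙ M *ₙ L) (total f) Ω)) ⟨
  ∑ Ω (λ v → M *ₙ M *ₙ 𝟙 (P? v) +ₙ 2 *ₙ K *ₙ K *ₙ M *ₙ L *ₙ total f v)
    ≤⟨ ∑-mono pointwise Ω ⟩
  ∑ Ω (λ v → K *ₙ K *ₙ (L *ₙ L) *ₙ (total f v *ₙ total f v) +ₙ K *ₙ K *ₙ (M *ₙ M))
    ≡⟨ trans (∑-distrib-+ _ _ Ω) (cong₂ _+ₙ_ (∑-distribˡ-* (K *ₙ K *ₙ (L *ₙ L)) _ Ω) (∑-const (K *ₙ K *ₙ (M *ₙ M)) Ω)) ⟩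
  K *ₙ K *ₙ (L *ₙ L) *ₙ S₂ +ₙ D *ₙ (K *ₙ K *ₙ (M *ₙ M))
    ≡⟨ cong (_+ₙ D *ₙ (K *ₙ K *ₙ (M *ₙ M))) (ℕ.*-assoc (K *ₙ K) (L *ₙ L) S₂) ⟩
  K *ₙ K *ₙ (L *ₙ L *ₙ S₂) +ₙ D *ₙ (K *ₙ K *ₙ (M *ₙ M))
    ≤⟨ ℕ.+-monoˡ-≤ _ (ℕ.*-monoʳ-≤ (K *ₙ K) (second-moment xs a len q f)) ⟩
  K *ₙ K *ₙ (D *ₙ (M *ₙ M +ₙ a *ₙ V)) +ₙ D *ₙ (K *ₙ K *ₙ (M *ₙ M))
    ≡⟨ collect K D M (a *ₙ V) ⟩
  K *ₙ K *ₙ (D *ₙ (a *ₙ V)) +ₙ 2 *ₙ K *ₙ K *ₙ D *ₙ M *ₙ M ∎)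
  where
  open ℕ.≤-Reasoning
  Ω = draws xs q
  L = length xs
  D = length Ω
  M = mass xs f
  V = mass² xs f
  c = ∑ Ω (𝟙 ∘ P?)
  S₁ = ∑ Ω (total f)
  S₂ = ∑ Ω (λ v → total f v *ₙ total f v)
  regroup : ∀ c m K D M → c *ₙ m +ₙ 2 *ₙ K *ₙ K *ₙ D *ₙ M *ₙ M ≡ m *ₙ c +ₙ 2 *ₙ K *ₙ K *ₙ M *ₙ (D *ₙ M)
  regroup = solve-∀
  collect : ∀ K D M W → K *ₙ K *ₙ (D *ₙ (M *ₙ M +ₙ W)) +ₙ D *ₙ (K *ₙ K *ₙ (M *ₙ M))
                        ≡ K *ₙ K *ₙ (D *ₙ W) +ₙ 2 *ₙ K *ₙ K *ₙ D *ₙ M *ₙ M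
  collect = solve-∀
  squares : ∀ K L F M → K *ₙ (L *ₙ F) *ₙ (K *ₙ (L *ₙ F)) +ₙ K *ₙ M *ₙ (K *ₙ M)
                        ≡ K *ₙ K *ₙ (L *ₙ L) *ₙ (F *ₙ F) +ₙ K *ₙ K *ₙ (M *ₙ M)
  squares = solve-∀
  cross : ∀ K L F M → 2 *ₙ K *ₙ K *ₙ M *ₙ L *ₙ F ≡ 2 *ₙ (K *ₙ (L *ₙ F)) *ₙ (K *ₙ M)
  cross = solve-∀
  pointwise : ∀ v → M *ₙ M *ₙ 𝟙 (P? v) +ₙ 2 *ₙ K *ₙ K *ₙ M *ₙ L *ₙ total f v
                    ≤ₙ K *ₙ K *ₙ (L *ₙ L) *ₙ (total f v *ₙ total f v) +ₙ K *ₙ K *ₙ (M *ₙ M)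
  pointwise v rewrite sym (squares K L (total f v) M) | cross K L (total f v) M with P? v
  ... | yes p rewrite ℕ.*-identityʳ (M *ₙ M) = apart⇒square-gap (apart v p)
  ... | no  _ rewrite ℕ.*-zeroʳ (M *ₙ M) = am-gm (K *ₙ (L *ₙ total f v)) (K *ₙ M)

-- Degrees, edges and light vertices

𝟙-cong : {X Y : Set} (x? : Dec X) (y? : Dec Y) → (X → Y) → (Y → X) → 𝟙 x? ≡ 𝟙 y?
𝟙-cong (yes _) (yes _) f g = refl
𝟙-cong (yes x) (no ¬y) f g = contradiction (f x) ¬y
𝟙-cong (no ¬x) (yes y) f g = contradiction (g y) ¬x
𝟙-cong (no _)  (no _)  f g = refl

∑-pick : ∀ {n} (v : Fin n) (f : Fin n → ℕ) → ∑ (allFin n) (λ u → 𝟙 (v Fin.≟ u) *ₙ f u) ≡ f v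
∑-pick {suc n} Fin.zero f = begin
  ∑ (allFin (suc n)) (λ u → 𝟙 (Fin.zero Fin.≟ u) *ₙ f u)
    ≡⟨ ∑-allFin-suc {n} (λ u → 𝟙 (Fin.zero Fin.≟ u) *ₙ f u) ⟩
  f Fin.zero +ₙ 0 +ₙ ∑ (allFin n) (λ _ → 0)
    ≡⟨ cong₂ _+ₙ_ (ℕ.+-identityʳ (f Fin.zero)) (trans (∑-const 0 (allFin n)) (ℕ.*-zeroʳ (length (allFin n)))) ⟩
  f Fin.zero +ₙ 0                                         ≡⟨ ℕ.+-identityʳ _ ⟩
  f Fin.zero                                              ∎
  where open ≡-Reasoning
∑-pick {suc n} (Fin.suc v) f = begin
  ∑ (allFin (suc n)) (λ u → 𝟙 (Fin.suc v Fin.≟ u) *ₙ f u)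
    ≡⟨ ∑-allFin-suc {n} (λ u → 𝟙 (Fin.suc v Fin.≟ u) *ₙ f u) ⟩
  ∑ (allFin n) (λ u → 𝟙 (Fin.suc v Fin.≟ Fin.suc u) *ₙ f (Fin.suc u))
    ≡⟨ ∑-cong (λ u → cong (_*ₙ f (Fin.suc u)) (𝟙-cong (Fin.suc v Fin.≟ Fin.suc u) (v Fin.≟ u) Fin.suc-injective (cong Fin.suc))) (allFin n) ⟩
  ∑ (allFin n) (λ u → 𝟙 (v Fin.≟ u) *ₙ f (Fin.suc u))              ≡⟨ ∑-pick v (f ∘ Fin.suc) ⟩
  f (Fin.suc v)                                                    ∎
  where open ≡-Reasoning

incidence : ∀ {n} → Fin n → Edge n → ℕ
incidence v (u , w) = 𝟙 (v Fin.≟ u) +ₙ 𝟙 (v Fin.≟ w)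

∑-incidence : ∀ {n} (g : Fin n → ℕ) u w →
  ∑ (allFin n) (λ v → g v *ₙ incidence v (u , w)) ≡ g u +ₙ g w
∑-incidence {n} g u w = begin
  ∑ (allFin n) (λ v → g v *ₙ (𝟙 (v Fin.≟ u) +ₙ 𝟙 (v Fin.≟ w)))
    ≡⟨ ∑-cong (λ v → trans (ℕ.*-distribˡ-+ (g v) _ _) (cong₂ _+ₙ_ (flip v u) (flip v w))) (allFin n) ⟩
  ∑ (allFin n) (λ v → 𝟙 (u Fin.≟ v) *ₙ g v +ₙ 𝟙 (w Fin.≟ v) *ₙ g v)
    ≡⟨ ∑-distrib-+ _ _ (allFin n) ⟩
  ∑ (allFin n) (λ v → 𝟙 (u Fin.≟ v) *ₙ g v) +ₙ ∑ (allFin n) (λ v → 𝟙 (w Fin.≟ v) *ₙ g v)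
    ≡⟨ cong₂ _+ₙ_ (∑-pick u g) (∑-pick w g) ⟩
  g u +ₙ g w ∎
  where
  open ≡-Reasoning
  flip : ∀ v u → g v *ₙ 𝟙 (v Fin.≟ u) ≡ 𝟙 (u Fin.≟ v) *ₙ g v
  flip v u = trans (ℕ.*-comm (g v) _) (cong (_*ₙ g v) (𝟙-cong (v Fin.≟ u) (u Fin.≟ v) sym sym))

module _ {n : ℕ} (G : Graph n) where
  open Graph G renaming (sym to adj-sym)

  private
    V = allFin n

    oriented? : (u w : Fin n) → Dec (u Fin.< w × Adj u w)
    oriented? u w = (u Fin.<? w) ×-dec adj? u w

  ∑-edges : (f : Edge n → ℕ) →
    ∑ (edges G) f ≡ ∑ V (λ u → ∑ V (λ w → 𝟙 (oriented? u w) *ₙ f (u , w)))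
  ∑-edges f = trans (∑-filter (λ (u , w) → oriented? u w) f (cartesianProduct V V))
                    (∑-cartesianProductWith _,_ (λ (u , w) → 𝟙 (oriented? u w) *ₙ f (u , w)) V V)

  -- An edge is stored only with increasing ends, so for adjacent `v` and `w` exactly one order
  -- counts: trichotomy leaves `v ≡ w` as the only other case, and irreflexivity excludes it.
  adj≡oriented : ∀ v w → 𝟙 (oriented? v w) +ₙ 𝟙 (oriented? w v) ≡ 𝟙 (adj? v w)
  adj≡oriented v w with adj? v w | adj? w v | v Fin.<? w | w Fin.<? v
  ... | no _   | no _  | yes _   | yes _   = refl
  ... | no _   | no _  | yes _   | no _    = refl
  ... | no _   | no _  | no _    | yes _   = refl
  ... | no _   | no _  | no _    | no _    = refl
  ... | no ¬vw | yes wv | _       | _       = contradiction (adj-sym wv) ¬vw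
  ... | yes vw | no ¬wv | _       | _       = contradiction (adj-sym vw) ¬wv
  ... | yes _  | yes _ | yes v<w | yes w<v = contradiction w<v (Fin.<-asym v<w)
  ... | yes _  | yes _ | yes _   | no _    = refl
  ... | yes _  | yes _ | no _    | yes _   = refl
  ... | yes vw | yes _ | no v≮w  | no w≮v with Fin.<-cmp v w
  ...   | tri< v<w _ _ = contradiction v<w v≮w
  ...   | tri≈ _ v≡w _ = contradiction vw (irrefl v≡w)
  ...   | tri> _ _ w<v = contradiction w<v w≮v

  degree≡∑incidence : ∀ v → degree G v ≡ ∑ (edges G) (incidence v)
  degree≡∑incidence v = begin
    degree G v
      ≡⟨ length-filter (adj? v) V ⟩
    ∑ V (λ w → 𝟙 (adj? v w))
      ≡⟨ ∑-cong (adj≡oriented v) V ⟨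
    ∑ V (λ w → 𝟙 (oriented? v w) +ₙ 𝟙 (oriented? w v))
      ≡⟨ ∑-distrib-+ _ _ V ⟩
    ∑ V (λ w → 𝟙 (oriented? v w)) +ₙ ∑ V (λ u → 𝟙 (oriented? u v))
      -- `∑-pick` read backwards inserts the two indicators of `incidence`, for the edges whose
      -- smaller or larger end is `v`.
      ≡⟨ cong₂ _+ₙ_ (∑-pick v (λ u → ∑ V (λ w → 𝟙 (oriented? u w))))
                    (∑-cong (λ u → ∑-pick v (λ w → 𝟙 (oriented? u w))) V) ⟨
    ∑ V (λ u → 𝟙 (v Fin.≟ u) *ₙ ∑ V (λ w → 𝟙 (oriented? u w)))
      +ₙ ∑ V (λ u → ∑ V (λ w → 𝟙 (v Fin.≟ w) *ₙ 𝟙 (oriented? u w)))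
      ≡⟨ ∑-distrib-+ _ _ V ⟨
    ∑ V (λ u → 𝟙 (v Fin.≟ u) *ₙ ∑ V (λ w → 𝟙 (oriented? u w))
      +ₙ ∑ V (λ w → 𝟙 (v Fin.≟ w) *ₙ 𝟙 (oriented? u w)))
      ≡⟨ ∑-cong (λ u → trans (cong (_+ₙ ∑ V (λ w → 𝟙 (v Fin.≟ w) *ₙ 𝟙 (oriented? u w)))
                                    (sym (∑-distribˡ-* (𝟙 (v Fin.≟ u)) (λ w → 𝟙 (oriented? u w)) V)))
                       (trans (sym (∑-distrib-+ _ _ V)) (∑-cong (λ w → factor (𝟙 (v Fin.≟ u)) (𝟙 (v Fin.≟ w)) (𝟙 (oriented? u w))) V))) V ⟩
    ∑ V (λ u → ∑ V (λ w → 𝟙 (oriented? u w) *ₙ incidence v (u , w)))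
      ≡⟨ ∑-edges (incidence v) ⟨
    ∑ (edges G) (incidence v) ∎
    where
    open ≡-Reasoning
    factor : ∀ a b c → a *ₙ c +ₙ b *ₙ c ≡ c *ₙ (a +ₙ b)
    factor = solve-∀

  -- Double counting of incidences. The weight is 1 for the total degree and the indicator of light
  -- vertices for the light degree.
  handshake : (g : Fin n → ℕ) →
    ∑ V (λ v → g v *ₙ degree G v) ≡ ∑ (edges G) (λ (u , w) → g u +ₙ g w)
  handshake g = begin
    ∑ V (λ v → g v *ₙ degree G v)
      ≡⟨ ∑-cong (λ v → trans (cong (g v *ₙ_) (degree≡∑incidence v)) (sym (∑-distribˡ-* (g v) (incidence v) (edges G)))) V ⟩
    ∑ V (λ v → ∑ (edges G) (λ e → g v *ₙ incidence v e))
      ≡⟨ ∑-swap (λ v e → g v *ₙ incidence v e) V (edges G) ⟩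
    ∑ (edges G) (λ e → ∑ V (λ v → g v *ₙ incidence v e))
      ≡⟨ ∑-cong (λ (u , w) → ∑-incidence g u w) (edges G) ⟩
    ∑ (edges G) (λ (u , w) → g u +ₙ g w) ∎
    where open ≡-Reasoning

  -- If 8 t² ≤ m, at most 2 t vertices are heavy, so at most half of the edges join two of them.
  module Light (t : ℕ) where

    light? : (v : Fin n) → Dec (t *ₙ degree G v ≤ₙ ∣E∣ G)
    light? v = t *ₙ degree G v ℕ.≤? ∣E∣ G

    lightDegree : Fin n → ℕ
    lightDegree v = 𝟙 (light? v) *ₙ degree G v

    heavy : Fin n → ℕ
    heavy v = 𝟙 (¬? (light? v))

    lightDegree≤degree : ∀ v → lightDegree v ≤ₙ degree G v
    lightDegree≤degree v = ℕ.≤-trans (ℕ.*-monoˡ-≤ (degree G v) (𝟙≤1 (light? v))) (ℕ.≤-reflexive (ℕ.*-identityˡ _))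

    -- A light vertex of degree `d` has `t d ≤ m`, hence `t d² ≤ m d`. This is the variance bound
    -- for the sampled light degrees.
    lightDegree-squares : t *ₙ ∑ V (λ v → lightDegree v *ₙ lightDegree v) ≤ₙ ∣E∣ G *ₙ ∑ V lightDegree
    lightDegree-squares = begin
      t *ₙ ∑ V (λ v → lightDegree v *ₙ lightDegree v)    ≡⟨ ∑-distribˡ-* t _ V ⟨
      ∑ V (λ v → t *ₙ (lightDegree v *ₙ lightDegree v))  ≤⟨ ∑-mono bound V ⟩
      ∑ V (λ v → ∣E∣ G *ₙ lightDegree v)                 ≡⟨ ∑-distribˡ-* (∣E∣ G) lightDegree V ⟩
      ∣E∣ G *ₙ ∑ V lightDegree                           ∎
      where
      open ℕ.≤-Reasoning
      bound : ∀ v → t *ₙ (lightDegree v *ₙ lightDegree v) ≤ₙ ∣E∣ G *ₙ lightDegree v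
      bound v with light? v
      ... | no _  = subst (_≤ₙ ∣E∣ G *ₙ 0) (sym (ℕ.*-zeroʳ t)) z≤n
      ... | yes p = begin
        t *ₙ (d *ₙ d)   ≡⟨ ℕ.*-assoc t d d ⟨
        t *ₙ d *ₙ d
          ≤⟨ ℕ.*-monoˡ-≤ d (subst (λ z → t *ₙ z ≤ₙ ∣E∣ G) (sym (ℕ.+-identityʳ (degree G v))) p) ⟩
        ∣E∣ G *ₙ d      ∎
        where d = degree G v +ₙ 0

    ∑-degree : ∑ V (degree G) ≡ ∣E∣ G *ₙ 2
    ∑-degree = begin
      ∑ V (degree G)                          ≡⟨ ∑-cong (λ v → ℕ.*-identityˡ (degree G v)) V ⟨
      ∑ V (λ v → 1 *ₙ degree G v)             ≡⟨ handshake (λ _ → 1) ⟩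
      ∑ (edges G) (λ _ → 2)                   ≡⟨ ∑-const 2 (edges G) ⟩
      ∣E∣ G *ₙ 2                              ∎
      where open ≡-Reasoning

    -- Markov's inequality: a heavy vertex of degree `d` has `m < t d`, and the degrees sum to
    -- `2 m`.
    ∑-heavy : .{{ℕ.NonZero (∣E∣ G)}} → ∑ V heavy ≤ₙ t *ₙ 2
    ∑-heavy = ℕ.*-cancelˡ-≤ (∣E∣ G) (begin
      ∣E∣ G *ₙ ∑ V heavy                ≡⟨ ∑-distribˡ-* (∣E∣ G) heavy V ⟨
      ∑ V (λ v → ∣E∣ G *ₙ heavy v)      ≤⟨ ∑-mono bound V ⟩
      ∑ V (λ v → t *ₙ degree G v)       ≡⟨ ∑-distribˡ-* t (degree G) V ⟩
      t *ₙ ∑ V (degree G)               ≡⟨ cong (t *ₙ_) ∑-degree ⟩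
      t *ₙ (∣E∣ G *ₙ 2)                 ≡⟨ swap t (∣E∣ G) ⟩
      ∣E∣ G *ₙ (t *ₙ 2)                 ∎)
      where
      open ℕ.≤-Reasoning
      swap : ∀ t m → t *ₙ (m *ₙ 2) ≡ m *ₙ (t *ₙ 2)
      swap = solve-∀
      bound : ∀ v → ∣E∣ G *ₙ heavy v ≤ₙ t *ₙ degree G v
      bound v with light? v
      ... | yes _ = subst (_≤ₙ t *ₙ degree G v) (sym (ℕ.*-zeroʳ (∣E∣ G))) z≤n
      ... | no ¬p = subst (_≤ₙ t *ₙ degree G v) (sym (ℕ.*-identityʳ (∣E∣ G))) (ℕ.<⇒≤ (ℕ.≰⇒> ¬p))

    ∑-edges-heavy : ∑ (edges G) (λ (u , w) → heavy u *ₙ heavy w) ≤ₙ ∑ V heavy *ₙ ∑ V heavy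
    ∑-edges-heavy = begin
      ∑ (edges G) (λ (u , w) → heavy u *ₙ heavy w)
        ≡⟨ ∑-edges (λ (u , w) → heavy u *ₙ heavy w) ⟩
      ∑ V (λ u → ∑ V (λ w → 𝟙 (oriented? u w) *ₙ (heavy u *ₙ heavy w)))
        ≤⟨ ∑-mono (λ u → ∑-mono (λ w → ℕ.*-monoˡ-≤ (heavy u *ₙ heavy w) (𝟙≤1 (oriented? u w))) V) V ⟩
      ∑ V (λ u → ∑ V (λ w → 1 *ₙ (heavy u *ₙ heavy w)))
        ≡⟨ ∑-cong (λ u → trans (∑-cong (λ w → ℕ.*-identityˡ (heavy u *ₙ heavy w)) V)
                        (trans (∑-distribˡ-* (heavy u) heavy V) (ℕ.*-comm (heavy u) (∑ V heavy)))) V ⟩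
      ∑ V (λ u → ∑ V heavy *ₙ heavy u)
        ≡⟨ ∑-distribˡ-* (∑ V heavy) heavy V ⟩
      ∑ V heavy *ₙ ∑ V heavy ∎
      where open ℕ.≤-Reasoning

    ∣E∣≤2∑lightDegree : .{{ℕ.NonZero (∣E∣ G)}} → 8 *ₙ (t *ₙ t) ≤ₙ ∣E∣ G → ∣E∣ G ≤ₙ 2 *ₙ ∑ V lightDegree
    -- With one more `m` on both sides, `8 t² ≤ m` absorbs twice the number of edges between heavy
    -- vertices, of which there are at most `(2 t)²`.
    ∣E∣≤2∑lightDegree 8t²≤m = ℕ.+-cancelˡ-≤ m _ _ (begin
      m +ₙ m                                ≡⟨ double m ⟩
      2 *ₙ m                                ≡⟨ cong (2 *ₙ_) (length≡∑1 (edges G)) ⟩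
      2 *ₙ ∑ (edges G) (λ _ → 1)
        ≤⟨ ℕ.*-monoʳ-≤ 2 (∑-mono (λ (u , w) → covered u w) (edges G)) ⟩
      2 *ₙ ∑ (edges G) (λ (u , w) → 𝟙 (light? u) +ₙ 𝟙 (light? w) +ₙ heavy u *ₙ heavy w)
                                            ≡⟨ cong (2 *ₙ_) (∑-distrib-+ (λ (u , w) → 𝟙 (light? u) +ₙ 𝟙 (light? w)) (λ (u , w) → heavy u *ₙ heavy w) (edges G)) ⟩
      2 *ₙ (∑ (edges G) (λ (u , w) → 𝟙 (light? u) +ₙ 𝟙 (light? w)) +ₙ ∑ (edges G) (λ (u , w) → heavy u *ₙ heavy w))
                                            ≡⟨ cong (λ z → 2 *ₙ (z +ₙ ∑ (edges G) (λ (u , w) → heavy u *ₙ heavy w))) (handshake (λ v → 𝟙 (light? v))) ⟨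
      2 *ₙ (M +ₙ ∑ (edges G) (λ (u , w) → heavy u *ₙ heavy w))
                                            ≤⟨ ℕ.*-monoʳ-≤ 2 (ℕ.+-monoʳ-≤ M (ℕ.≤-trans ∑-edges-heavy (ℕ.*-mono-≤ ∑-heavy ∑-heavy))) ⟩
      2 *ₙ (M +ₙ t *ₙ 2 *ₙ (t *ₙ 2))        ≡⟨ regroup M t ⟩
      8 *ₙ (t *ₙ t) +ₙ 2 *ₙ M               ≤⟨ ℕ.+-monoˡ-≤ (2 *ₙ M) 8t²≤m ⟩
      m +ₙ 2 *ₙ M                           ∎)
      where
      open ℕ.≤-Reasoning
      m = ∣E∣ G
      M = ∑ V lightDegree
      double : ∀ m → m +ₙ m ≡ 2 *ₙ m
      double = solve-∀
      regroup : ∀ M t → 2 *ₙ (M +ₙ t *ₙ 2 *ₙ (t *ₙ 2)) ≡ 8 *ₙ (t *ₙ t) +ₙ 2 *ₙ M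
      regroup = solve-∀
      covered : ∀ u w → 1 ≤ₙ 𝟙 (light? u) +ₙ 𝟙 (light? w) +ₙ heavy u *ₙ heavy w
      covered u w with light? u | light? w
      ... | yes _ | yes _ = s≤s z≤n
      ... | yes _ | no  _ = s≤s z≤n
      ... | no  _ | yes _ = s≤s z≤n
      ... | no  _ | no  _ = s≤s z≤n

-- The sampling algorithm

∑-⊎ : ∀ m n (f : Fin m ⊎ Fin n → ℕ) →
  ∑ (allFin (m +ₙ n)) (f ∘ Fin.splitAt m) ≡ ∑ (allFin m) (f ∘ inj₁) +ₙ ∑ (allFin n) (f ∘ inj₂)
∑-⊎ m n f = trans (∑-splitAt m n (f ∘ Fin.splitAt m))
  (cong₂ _+ₙ_ (∑-cong (λ i → cong f (Fin.splitAt-↑ˡ m i n)) (allFin m))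
              (∑-cong (λ j → cong f (Fin.splitAt-↑ʳ m n j)) (allFin n)))

length-allFin : ∀ n → length (allFin n) ≡ n
length-allFin n = length-tabulate {n = n} id

∑-cast : ∀ {m n} (eq : m ≡ n) (f : Fin n → ℕ) → ∑ (allFin m) (f ∘ Fin.cast eq) ≡ ∑ (allFin n) f
∑-cast {m} refl f = ∑-cong (λ i → cong f (Fin.cast-is-id refl i)) (allFin m)

∑-zero : (xs : List A) → ∑ xs (λ _ → 0) ≡ 0
∑-zero xs = trans (∑-const 0 xs) (ℕ.*-zeroʳ (length xs))

draws-nonEmpty : (xs : List A) → 0 <ₙ length xs → ∀ q → 0 <ₙ length (draws xs q)
draws-nonEmpty xs xs>0 zero    = s≤s z≤n
draws-nonEmpty xs xs>0 (suc q) rewrite length-draws xs q = ℕ.*-mono-< xs>0 (draws-nonEmpty xs xs>0 q)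

allFin-nonEmpty : ∀ n → 0 <ₙ length (allFin (suc n))
allFin-nonEmpty n = s≤s z≤n

ratio : ℕ → ℕ → ℚ
ratio x zero    = 0ℚ
ratio x (suc h) = + x / suc h

-- The s · (a + 1) = n + c positions are filled with the n vertices and c blanks, and cut into s blocks.
module Sampler (n s a q c : ℕ) (cover : s *ₙ suc a ≡ n +ₙ c) where

  vertex : Fin s → Fin (suc a) → Maybe (Fin n)
  vertex i x = [ just , const nothing ]′ (Fin.splitAt n (Fin.cast cover (Fin.combine i x)))

  ∑-vertex : (f : Fin n → ℕ) →
    ∑ (allFin s) (λ i → ∑ (allFin (suc a)) (λ x → maybe′ f 0 (vertex i x))) ≡ ∑ (allFin n) f
  ∑-vertex f = begin
    ∑ (allFin s) (λ i → ∑ (allFin (suc a)) (λ x → g (Fin.splitAt n (Fin.cast cover (Fin.combine i x)))))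
      ≡⟨ ∑-combine s (suc a) (g ∘ Fin.splitAt n ∘ Fin.cast cover) ⟨
    ∑ (allFin (s *ₙ suc a)) (g ∘ Fin.splitAt n ∘ Fin.cast cover)
      ≡⟨ ∑-cast cover (g ∘ Fin.splitAt n) ⟩
    ∑ (allFin (n +ₙ c)) (g ∘ Fin.splitAt n)
      ≡⟨ ∑-⊎ n c g ⟩
    ∑ (allFin n) f +ₙ ∑ (allFin c) (λ _ → 0)
      ≡⟨ cong (∑ (allFin n) f +ₙ_) (∑-zero (allFin c)) ⟩
    ∑ (allFin n) f +ₙ 0
      ≡⟨ ℕ.+-identityʳ _ ⟩
    ∑ (allFin n) f ∎
    where
    open ≡-Reasoning
    g : Fin n ⊎ Fin c → ℕ
    g = maybe′ f 0 ∘ [ just , const nothing ]′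

  Sample : Set
  Sample = Vec (Fin (suc a)) s

  samples : List Sample
  samples = draws (allFin (suc a)) s

  -- A blank position must still issue a query, as their number is fixed; it asks for a random edge
  -- whose answer is ignored.
  probe : Sample → Fin s ⊎ Fin q → Query n
  probe σ (inj₁ i) = maybe′ Deg RandEdge (vertex i (Vec.lookup σ i))
  probe σ (inj₂ j) = RandEdge

  hits : Sample → Edge n → ℕ
  hits σ e = total (λ i x → maybe′ (λ v → incidence v e) 0 (vertex i x)) σ

  degreeAnswer : (x : Query n) → Answer x → ℕ
  degreeAnswer (Deg v)  d = d
  degreeAnswer RandEdge e = 0

  hitsAnswer : Sample → Fin s ⊎ Fin q → (x : Query n) → Answer x → ℕ
  hitsAnswer σ (inj₁ i) x        _ = 0
  hitsAnswer σ (inj₂ j) (Deg v)  d = 0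
  hitsAnswer σ (inj₂ j) RandEdge e = hits σ e

  sampler : NonAdaptive n
  sampler = record
    { seeds         = length samples
    ; seeds-nonZero = ℕ.>-nonZero (draws-nonEmpty (allFin (suc a)) (allFin-nonEmpty a) s)
    ; queryCount    = s +ₙ q
    ; query         = λ ω k → probe (lookup samples ω) (Fin.splitAt s k)
    ; estimate      = λ ω answer → let σ = lookup samples ω in ratio
        (q *ₙ ∑ (allFin (s +ₙ q)) (λ k → degreeAnswer (probe σ (Fin.splitAt s k)) (answer k)))
        (∑ (allFin (s +ₙ q)) (λ k → hitsAnswer σ (Fin.splitAt s k) (probe σ (Fin.splitAt s k)) (answer k)))
    }

  module Analysis (G : Graph n) where

    private
      b = suc a
      m = ∣E∣ G
      Draw = Vec (Edge n) (s +ₙ q)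

    edgeDraws : List Draw
    edgeDraws = draws (edges G) (s +ₙ q)

    degreeSum : Sample → ℕ
    degreeSum = total (λ i x → maybe′ (degree G) 0 (vertex i x))

    -- The zero on the first `s` coordinates discards the edge draws that are reserved for degree
    -- queries and blanks.
    hitsAt : Sample → Fin (s +ₙ q) → Edge n → ℕ
    hitsAt σ k e = [ const 0 , const (hits σ e) ]′ (Fin.splitAt s k)

    hitSum : Sample → Draw → ℕ
    hitSum σ = total (hitsAt σ)

    output≡ : ∀ ω es → let σ = lookup samples ω in
      output sampler G (ω , es) ≡ ratio (q *ₙ degreeSum σ) (hitSum σ es)
    output≡ ω es = cong₂ (λ d h → ratio (q *ₙ d) h) degrees (∑-cong (λ k → hit (Fin.splitAt s k) (Vec.lookup es k)) (allFin (s +ₙ q)))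
      where
      σ = lookup samples ω
      open ≡-Reasoning
      trueDegree : Query n → ℕ
      trueDegree (Deg v)  = degree G v
      trueDegree RandEdge = 0
      degree-respond : ∀ e x → degreeAnswer x (respond G e x) ≡ trueDegree x
      degree-respond e (Deg v)  = refl
      degree-respond e RandEdge = refl
      trueDegree-maybe : ∀ v → trueDegree (maybe′ Deg RandEdge v) ≡ maybe′ (degree G) 0 v
      trueDegree-maybe (just v) = refl
      trueDegree-maybe nothing  = refl
      hit : ∀ k e → hitsAnswer σ k (probe σ k) (respond G e (probe σ k)) ≡ [ const 0 , const (hits σ e) ]′ k
      hit (inj₁ i) e = refl
      hit (inj₂ j) e = refl
      degrees : ∑ (allFin (s +ₙ q)) (λ k → degreeAnswer (probe σ (Fin.splitAt s k))
                  (respond G (Vec.lookup es k) (probe σ (Fin.splitAt s k)))) ≡ degreeSum σ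
      degrees = begin
        ∑ (allFin (s +ₙ q)) (λ k → degreeAnswer (probe σ (Fin.splitAt s k)) (respond G (Vec.lookup es k) (probe σ (Fin.splitAt s k))))
          ≡⟨ ∑-cong (λ k → degree-respond (Vec.lookup es k) (probe σ (Fin.splitAt s k))) (allFin (s +ₙ q)) ⟩
        ∑ (allFin (s +ₙ q)) (trueDegree ∘ probe σ ∘ Fin.splitAt s)
          ≡⟨ ∑-⊎ s q (trueDegree ∘ probe σ) ⟩
        ∑ (allFin s) (λ i → trueDegree (maybe′ Deg RandEdge (vertex i (Vec.lookup σ i)))) +ₙ ∑ (allFin q) (λ _ → 0)
          ≡⟨ cong₂ _+ₙ_ (∑-cong (λ i → trueDegree-maybe (vertex i (Vec.lookup σ i))) (allFin s)) (∑-zero (allFin q)) ⟩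
        degreeSum σ +ₙ 0
          ≡⟨ ℕ.+-identityʳ _ ⟩
        degreeSum σ ∎

    -- Lower bound on the sampled degree sum

    Dense : Sample → Set
    Dense σ = m ≤ₙ 4 *ₙ (b *ₙ degreeSum σ)

    dense? : Decidable Dense
    dense? σ = m ℕ.≤? 4 *ₙ (b *ₙ degreeSum σ)

    private
      maybe-mono : {f g : Fin n → ℕ} → (∀ v → f v ≤ₙ g v) → ∀ v → maybe′ f 0 v ≤ₙ maybe′ g 0 v
      maybe-mono f≤g (just v) = f≤g v
      maybe-mono f≤g nothing  = z≤n

      maybe-square : (f : Fin n → ℕ) → ∀ v → maybe′ f 0 v *ₙ maybe′ f 0 v ≡ maybe′ (λ v → f v *ₙ f v) 0 v
      maybe-square f (just v) = refl
      maybe-square f nothing  = refl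

    -- The sampled light degrees sum to some `F ≤ D` of mean `M / b ≥ m / (2 b)`, so a sparse sample
    -- pushes `F` to at most half its mean and Chebyshev applies with `K = 2`. In `t = 64 a`, 64 is
    -- `4 · 2 · 8`: the factor `K²`, the loss in `m ≤ 2 M`, and the failure probability 1/8.
    few-sparse : .{{ℕ.NonZero m}} → 8 *ₙ (64 *ₙ a *ₙ (64 *ₙ a)) ≤ₙ m →
      8 *ₙ ∑ samples (λ σ → 𝟙 (¬? (dense? σ))) ≤ₙ length samples
    few-sparse threshold = ℕ.*-cancelˡ-≤ (2 *ₙ (M *ₙ M)) {{M²-nonZero}} (begin
      2 *ₙ (M *ₙ M) *ₙ (8 *ₙ count)           ≡⟨ regroup₁ M count ⟩
      16 *ₙ (count *ₙ (M *ₙ M))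
        ≤⟨ ℕ.*-monoʳ-≤ 16 (subst₂ (λ μ v → count *ₙ (μ *ₙ μ) ≤ₙ 2 *ₙ 2 *ₙ (S *ₙ (a *ₙ v))) mass≡ mass²≡ tail) ⟩
      16 *ₙ (2 *ₙ 2 *ₙ (S *ₙ (a *ₙ W)))       ≡⟨ regroup₂ S a W ⟩
      S *ₙ (64 *ₙ a *ₙ W)                     ≤⟨ ℕ.*-monoʳ-≤ S lightDegree-squares ⟩
      S *ₙ (m *ₙ M)                           ≤⟨ ℕ.*-monoʳ-≤ S (ℕ.*-monoˡ-≤ M m≤2M) ⟩
      S *ₙ (2 *ₙ M *ₙ M)                      ≡⟨ regroup₃ S M ⟩
      2 *ₙ (M *ₙ M) *ₙ S                      ∎)
      where
      open ℕ.≤-Reasoning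
      open Light G (64 *ₙ a)
      f : Fin s → Fin b → ℕ
      f i x = maybe′ lightDegree 0 (vertex i x)
      M = ∑ (allFin n) lightDegree
      W = ∑ (allFin n) (λ v → lightDegree v *ₙ lightDegree v)
      S = length samples
      count = ∑ samples (λ σ → 𝟙 (¬? (dense? σ)))
      m≤2M : m ≤ₙ 2 *ₙ M
      m≤2M = ∣E∣≤2∑lightDegree threshold
      M>0 : 0 <ₙ M
      M>0 = ℕ.*-cancelˡ-< 2 0 M (ℕ.<-≤-trans (ℕ.>-nonZero⁻¹ m) m≤2M)
      M²-nonZero : ℕ.NonZero (2 *ₙ (M *ₙ M))
      M²-nonZero = ℕ.>-nonZero (ℕ.*-mono-< {0} {2} (s≤s z≤n) (ℕ.*-mono-< M>0 M>0))
      mass≡ : mass (allFin b) f ≡ M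
      mass≡ = ∑-vertex lightDegree
      mass²≡ : mass² (allFin b) f ≡ W
      mass²≡ = trans (∑-cong (λ i → ∑-cong (λ x → maybe-square lightDegree (vertex i x)) (allFin b)) (allFin s))
                     (∑-vertex (λ v → lightDegree v *ₙ lightDegree v))
      below : ∀ σ → ¬ Dense σ → 2 *ₙ (length (allFin b) *ₙ total f σ) +ₙ mass (allFin b) f ≤ₙ 2 *ₙ mass (allFin b) f
      below σ ¬dense = subst₂ (λ l μ → 2 *ₙ (l *ₙ total f σ) +ₙ μ ≤ₙ 2 *ₙ μ) (sym (length-allFin b)) (sym mass≡) (begin
        2 *ₙ (b *ₙ total f σ) +ₙ M
          ≤⟨ ℕ.+-monoˡ-≤ M (ℕ.*-monoʳ-≤ 2 (ℕ.*-monoʳ-≤ b (∑-mono (λ i → maybe-mono lightDegree≤degree (vertex i (Vec.lookup σ i))) (allFin s)))) ⟩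
        2 *ₙ (b *ₙ degreeSum σ) +ₙ M      ≤⟨ ℕ.+-monoˡ-≤ M (ℕ.*-cancelˡ-≤ 2 (begin
          2 *ₙ (2 *ₙ (b *ₙ degreeSum σ))    ≡⟨ ℕ.*-assoc 2 2 (b *ₙ degreeSum σ) ⟨
          4 *ₙ (b *ₙ degreeSum σ)           ≤⟨ ℕ.<⇒≤ (ℕ.≰⇒> ¬dense) ⟩
          m                                 ≤⟨ m≤2M ⟩
          2 *ₙ M                            ∎)) ⟩
        M +ₙ M                            ≡⟨ cong (M +ₙ_) (ℕ.+-identityʳ M) ⟨
        2 *ₙ M                            ∎)
      tail : count *ₙ (mass (allFin b) f *ₙ mass (allFin b) f) ≤ₙ 2 *ₙ 2 *ₙ (S *ₙ (a *ₙ mass² (allFin b) f))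
      tail = chebyshev (allFin b) a (length-allFin b) f 2 (¬? ∘ dense?) (λ σ → inj₁ ∘ below σ)
      regroup₁ : ∀ M c → 2 *ₙ (M *ₙ M) *ₙ (8 *ₙ c) ≡ 16 *ₙ (c *ₙ (M *ₙ M))
      regroup₁ = solve-∀
      regroup₂ : ∀ S a W → 16 *ₙ (2 *ₙ 2 *ₙ (S *ₙ (a *ₙ W))) ≡ S *ₙ (64 *ₙ a *ₙ W)
      regroup₂ = solve-∀
      regroup₃ : ∀ S M → S *ₙ (2 *ₙ M *ₙ M) ≡ 2 *ₙ (M *ₙ M) *ₙ S
      regroup₃ = solve-∀

    -- Mean and deviation of the number of hits

    ∑-hits : ∀ σ → ∑ (edges G) (hits σ) ≡ degreeSum σ
    ∑-hits σ = begin
      ∑ (edges G) (hits σ)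
        ≡⟨ ∑-swap (λ e i → maybe′ (λ v → incidence v e) 0 (vertex i (Vec.lookup σ i))) (edges G) (allFin s) ⟩
      ∑ (allFin s) (λ i → ∑ (edges G) (λ e → maybe′ (λ v → incidence v e) 0 (vertex i (Vec.lookup σ i))))
        ≡⟨ ∑-cong (λ i → at (vertex i (Vec.lookup σ i))) (allFin s) ⟩
      degreeSum σ ∎
      where
      open ≡-Reasoning
      at : ∀ v → ∑ (edges G) (λ e → maybe′ (λ v → incidence v e) 0 v) ≡ maybe′ (degree G) 0 v
      at (just v) = sym (degree≡∑incidence G v)
      at nothing  = ∑-zero (edges G)

    -- Distinct positions hold distinct vertices. Extending the sum from the sampled position of
    -- each block to all of its positions therefore runs over each vertex once, and only the two
    -- ends of `e` contribute.
    hits≤2 : ∀ σ e → hits σ e ≤ₙ 2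
    hits≤2 σ e@(u , w) = begin
      hits σ e
        ≤⟨ ∑-mono (λ i → single (Vec.lookup σ i) (λ x → maybe′ (λ v → incidence v e) 0 (vertex i x))) (allFin s) ⟩
      ∑ (allFin s) (λ i → ∑ (allFin b) (λ x → maybe′ (λ v → incidence v e) 0 (vertex i x)))
        ≡⟨ ∑-vertex (λ v → incidence v e) ⟩
      ∑ (allFin n) (λ v → incidence v e)
        ≡⟨ ∑-cong (λ v → ℕ.*-identityˡ (incidence v e)) (allFin n) ⟨
      ∑ (allFin n) (λ v → 1 *ₙ incidence v e)
        ≡⟨ ∑-incidence (λ _ → 1) u w ⟩
      2 ∎
      where
      open ℕ.≤-Reasoning
      single : ∀ x (g : Fin b → ℕ) → g x ≤ₙ ∑ (allFin b) g
      single x g = begin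
        g x                                              ≡⟨ ∑-pick x g ⟨
        ∑ (allFin b) (λ y → 𝟙 (x Fin.≟ y) *ₙ g y)
          ≤⟨ ∑-mono (λ y → ℕ.≤-trans (ℕ.*-monoˡ-≤ (g y) (𝟙≤1 (x Fin.≟ y))) (ℕ.≤-reflexive (ℕ.*-identityˡ (g y)))) (allFin b) ⟩
        ∑ (allFin b) g                                   ∎

    -- Taken with `φ` the identity for the mean and with `φ` the square for the variance; `φ 0 ≡ 0`
    -- removes the first `s` coordinates.
    ∑-hitsAt : (σ : Sample) (φ : ℕ → ℕ) → φ 0 ≡ 0 →
      ∑ (allFin (s +ₙ q)) (λ k → ∑ (edges G) (λ e → φ (hitsAt σ k e))) ≡ q *ₙ ∑ (edges G) (φ ∘ hits σ)
    ∑-hitsAt σ φ φ0 = begin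
      ∑ (allFin (s +ₙ q)) (λ k → ∑ (edges G) (λ e → φ (hitsAt σ k e)))
        ≡⟨ ∑-⊎ s q (λ k → ∑ (edges G) (λ e → φ ([ const 0 , const (hits σ e) ]′ k))) ⟩
      ∑ (allFin s) (λ _ → ∑ (edges G) (λ _ → φ 0)) +ₙ ∑ (allFin q) (λ _ → ∑ (edges G) (φ ∘ hits σ))
        ≡⟨ cong₂ _+ₙ_ (trans (∑-cong (λ _ → trans (∑-cong (λ _ → φ0) (edges G)) (∑-zero (edges G))) (allFin s)) (∑-zero (allFin s)))
                      (trans (∑-const (∑ (edges G) (φ ∘ hits σ)) (allFin q)) (cong (_*ₙ ∑ (edges G) (φ ∘ hits σ)) (length-allFin q))) ⟩
      q *ₙ ∑ (edges G) (φ ∘ hits σ) ∎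
      where open ≡-Reasoning

    module Accuracy (N : ℕ) where

      -- This is `|m H − q D| ≤ q D / (2 N)` without subtraction or division. The 2 leaves room for
      -- `near⇒bounds`, where the error is measured against `m H` instead.
      Near : Sample → Draw → Set
      Near σ es = 2 *ₙ N *ₙ (q *ₙ degreeSum σ) ≤ₙ 2 *ₙ N *ₙ (m *ₙ hitSum σ es) +ₙ q *ₙ degreeSum σ
                × 2 *ₙ N *ₙ (m *ₙ hitSum σ es) ≤ₙ 2 *ₙ N *ₙ (q *ₙ degreeSum σ) +ₙ q *ₙ degreeSum σ

      near? : ∀ σ → Decidable (Near σ)
      near? σ es = (_ ℕ.≤? _) ×-dec (_ ℕ.≤? _)

      -- As `h² ≤ 2 h`, the sum of squares `W` is at most `2 q D`. Chebyshev with `K = 2 N` then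
      -- bounds the probability by `4 N² m · 2 q D / (q D)² = 8 N² m / (q D)`, which is at most 1/8
      -- once `q D ≥ 64 N² m`.
      few-far : .{{ℕ.NonZero m}} → ∀ σ .{{_ : ℕ.NonZero (q *ₙ degreeSum σ)}} →
        64 *ₙ (N *ₙ N *ₙ m) ≤ₙ q *ₙ degreeSum σ →
        8 *ₙ ∑ edgeDraws (λ es → 𝟙 (¬? (near? σ es))) ≤ₙ length edgeDraws
      few-far σ enough = ℕ.*-cancelˡ-≤ (M *ₙ M) {{ℕ.m*n≢0 M M}} (begin
        M *ₙ M *ₙ (8 *ₙ count)                                    ≡⟨ regroup₁ M count ⟩
        8 *ₙ (count *ₙ (M *ₙ M))                                  ≤⟨ ℕ.*-monoʳ-≤ 8 tail ⟩
        8 *ₙ (2 *ₙ N *ₙ (2 *ₙ N) *ₙ (E *ₙ (ℕ.pred m *ₙ W)))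
          ≤⟨ ℕ.*-monoʳ-≤ 8 (ℕ.*-monoʳ-≤ (2 *ₙ N *ₙ (2 *ₙ N)) (ℕ.*-monoʳ-≤ E (ℕ.*-mono-≤ {ℕ.pred m} {m} ℕ.pred[n]≤n W≤))) ⟩
        8 *ₙ (2 *ₙ N *ₙ (2 *ₙ N) *ₙ (E *ₙ (m *ₙ (q *ₙ (2 *ₙ D)))))  ≡⟨ regroup₂ N E m q D ⟩
        E *ₙ (64 *ₙ (N *ₙ N *ₙ m) *ₙ M)
          ≤⟨ ℕ.*-monoʳ-≤ E (ℕ.*-monoˡ-≤ M enough) ⟩
        E *ₙ (M *ₙ M)                                             ≡⟨ ℕ.*-comm E (M *ₙ M) ⟩
        M *ₙ M *ₙ E                                               ∎)
        where
        open ℕ.≤-Reasoning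
        D = degreeSum σ
        M = q *ₙ D
        E = length edgeDraws
        W = mass² (edges G) (hitsAt σ)
        count = ∑ edgeDraws (λ es → 𝟙 (¬? (near? σ es)))
        mass≡ : mass (edges G) (hitsAt σ) ≡ M
        mass≡ = trans (∑-hitsAt σ id refl) (cong (q *ₙ_) (∑-hits σ))
        W≤ : W ≤ₙ q *ₙ (2 *ₙ D)
        W≤ = begin
          W                                                ≡⟨ ∑-hitsAt σ (λ h → h *ₙ h) refl ⟩
          q *ₙ ∑ (edges G) (λ e → hits σ e *ₙ hits σ e)
            ≤⟨ ℕ.*-monoʳ-≤ q (∑-mono (λ e → ℕ.*-monoˡ-≤ (hits σ e) (hits≤2 σ e)) (edges G)) ⟩
          q *ₙ ∑ (edges G) (λ e → 2 *ₙ hits σ e)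
            ≡⟨ cong (q *ₙ_) (trans (∑-distribˡ-* 2 (hits σ) (edges G)) (cong (2 *ₙ_) (∑-hits σ))) ⟩
          q *ₙ (2 *ₙ D)                                    ∎
        apart : ∀ es → ¬ Near σ es → let μ = mass (edges G) (hitsAt σ) ; X = 2 *ₙ N *ₙ (m *ₙ hitSum σ es) in
          X +ₙ μ ≤ₙ 2 *ₙ N *ₙ μ ⊎ 2 *ₙ N *ₙ μ +ₙ μ ≤ₙ X
        apart es ¬near rewrite mass≡
          with 2 *ₙ N *ₙ M ℕ.≤? 2 *ₙ N *ₙ (m *ₙ hitSum σ es) +ₙ M
        ... | no ≰    = inj₁ (ℕ.<⇒≤ (ℕ.≰⇒> ≰))
        ... | yes low with 2 *ₙ N *ₙ (m *ₙ hitSum σ es) ℕ.≤? 2 *ₙ N *ₙ M +ₙ M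
        ...   | no ≰     = inj₂ (ℕ.<⇒≤ (ℕ.≰⇒> ≰))
        ...   | yes high = contradiction (low , high) ¬near
        tail : count *ₙ (M *ₙ M) ≤ₙ 2 *ₙ N *ₙ (2 *ₙ N) *ₙ (E *ₙ (ℕ.pred m *ₙ W))
        tail = subst (λ μ → count *ₙ (μ *ₙ μ) ≤ₙ 2 *ₙ N *ₙ (2 *ₙ N) *ₙ (E *ₙ (ℕ.pred m *ₙ W))) mass≡
          (chebyshev (edges G) (ℕ.pred m) (sym (ℕ.suc-pred m)) (hitsAt σ) (2 *ₙ N) (λ es → ¬? (near? σ es)) apart)
        regroup₁ : ∀ M c → M *ₙ M *ₙ (8 *ₙ c) ≡ 8 *ₙ (c *ₙ (M *ₙ M))
        regroup₁ = solve-∀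
        regroup₂ : ∀ N E m q D → 8 *ₙ (2 *ₙ N *ₙ (2 *ₙ N) *ₙ (E *ₙ (m *ₙ (q *ₙ (2 *ₙ D)))))
                                 ≡ E *ₙ (64 *ₙ (N *ₙ N *ₙ m) *ₙ (q *ₙ D))
        regroup₂ = solve-∀

      -- Union bound over the seed and the edge draws

      Good : Outcome sampler G → Set
      Good (ω , es) = Dense (lookup samples ω) × Near (lookup samples ω) es

      good? : Decidable Good
      good? (ω , es) = dense? (lookup samples ω) ×-dec near? (lookup samples ω) es

      module _ .{{_ : ℕ.NonZero m}} .{{_ : ℕ.NonZero N}} (q-large : 256 *ₙ (N *ₙ N *ₙ b) ≤ₙ q) where

        dense⇒enough : ∀ σ → Dense σ → 64 *ₙ (N *ₙ N *ₙ m) ≤ₙ q *ₙ degreeSum σ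
        dense⇒enough σ dense = begin
          64 *ₙ (N *ₙ N *ₙ m)
            ≤⟨ ℕ.*-monoʳ-≤ 64 (ℕ.*-monoʳ-≤ (N *ₙ N) dense) ⟩
          64 *ₙ (N *ₙ N *ₙ (4 *ₙ (b *ₙ degreeSum σ)))       ≡⟨ regroup N b (degreeSum σ) ⟩
          256 *ₙ (N *ₙ N *ₙ b) *ₙ degreeSum σ               ≤⟨ ℕ.*-monoˡ-≤ (degreeSum σ) q-large ⟩
          q *ₙ degreeSum σ                                  ∎
          where
          open ℕ.≤-Reasoning
          regroup : ∀ N b D → 64 *ₙ (N *ₙ N *ₙ (4 *ₙ (b *ₙ D))) ≡ 256 *ₙ (N *ₙ N *ₙ b) *ₙ D
          regroup = solve-∀

        dense⇒nonZero : ∀ σ → Dense σ → ℕ.NonZero (q *ₙ degreeSum σ)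
        dense⇒nonZero σ dense = ℕ.>-nonZero (ℕ.<-≤-trans
          (ℕ.*-mono-< {0} {64} (s≤s z≤n) (ℕ.*-mono-< (ℕ.*-mono-< (ℕ.>-nonZero⁻¹ N) (ℕ.>-nonZero⁻¹ N)) (ℕ.>-nonZero⁻¹ m)))
          (dense⇒enough σ dense))

        -- A dense seed has at most 1/8 of its edge draws far; a sparse seed is charged with all of
        -- its draws, and at most 1/8 of the seeds are sparse.
        few-bad : 8 *ₙ (64 *ₙ a *ₙ (64 *ₙ a)) ≤ₙ m →
          4 *ₙ ∑ (outcomes sampler G) (λ x → 𝟙 (¬? (good? x))) ≤ₙ length (outcomes sampler G)
        few-bad threshold = ℕ.*-cancelˡ-≤ 2 (begin
          2 *ₙ (4 *ₙ ∑ (outcomes sampler G) (λ x → 𝟙 (¬? (good? x))))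
            ≡⟨ ℕ.*-assoc 2 4 (∑ (outcomes sampler G) (λ x → 𝟙 (¬? (good? x)))) ⟨
          8 *ₙ ∑ (outcomes sampler G) (λ x → 𝟙 (¬? (good? x)))
            ≡⟨ cong (8 *ₙ_) (∑-cartesianProductWith _,_ (λ x → 𝟙 (¬? (good? x))) (allFin S) edgeDraws) ⟩
          8 *ₙ ∑ (allFin S) (bad ∘ lookup samples)
            ≡⟨ cong (8 *ₙ_) (∑-lookup samples bad) ⟩
          8 *ₙ ∑ samples bad
            ≡⟨ ∑-distribˡ-* 8 bad samples ⟨
          ∑ samples (λ σ → 8 *ₙ bad σ)
            ≤⟨ ∑-mono bound samples ⟩
          ∑ samples (λ σ → E +ₙ E *ₙ 8 *ₙ 𝟙 (¬? (dense? σ)))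
            ≡⟨ trans (∑-distrib-+ _ _ samples) (cong₂ _+ₙ_ (∑-const E samples) (∑-distribˡ-* (E *ₙ 8) (λ σ → 𝟙 (¬? (dense? σ))) samples)) ⟩
          S *ₙ E +ₙ E *ₙ 8 *ₙ ∑ samples (λ σ → 𝟙 (¬? (dense? σ)))
            ≡⟨ cong (S *ₙ E +ₙ_) (ℕ.*-assoc E 8 _) ⟩
          S *ₙ E +ₙ E *ₙ (8 *ₙ ∑ samples (λ σ → 𝟙 (¬? (dense? σ))))
            ≤⟨ ℕ.+-monoʳ-≤ (S *ₙ E) (ℕ.*-monoʳ-≤ E (few-sparse threshold)) ⟩
          S *ₙ E +ₙ E *ₙ S
            ≡⟨ double S E ⟩
          2 *ₙ (S *ₙ E)
            ≡⟨ cong (λ z → 2 *ₙ (z *ₙ E)) (length-allFin S) ⟨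
          2 *ₙ (length (allFin S) *ₙ E)
            ≡⟨ cong (2 *ₙ_) (length-cartesianProductWith _,_ (allFin S) edgeDraws) ⟨
          2 *ₙ length (outcomes sampler G) ∎)
          where
          open ℕ.≤-Reasoning
          S = length samples
          E = length edgeDraws
          bad : Sample → ℕ
          bad σ = ∑ edgeDraws (λ es → 𝟙 (¬? (dense? σ ×-dec near? σ es)))
          double : ∀ S E → S *ₙ E +ₙ E *ₙ S ≡ 2 *ₙ (S *ₙ E)
          double = solve-∀
          bound : ∀ σ → 8 *ₙ bad σ ≤ₙ E +ₙ E *ₙ 8 *ₙ 𝟙 (¬? (dense? σ))
          bound σ with dense? σ
          ... | yes dense = begin
            8 *ₙ ∑ edgeDraws (λ es → 𝟙 (¬? (yes dense ×-dec near? σ es)))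
              ≡⟨ cong (8 *ₙ_) (∑-cong (λ es → 𝟙-cong (¬? (yes dense ×-dec near? σ es)) (¬? (near? σ es))
                   (λ ¬both near → ¬both (dense , near)) (λ ¬near → ¬near ∘ proj₂)) edgeDraws) ⟩
            8 *ₙ ∑ edgeDraws (λ es → 𝟙 (¬? (near? σ es)))
              ≤⟨ few-far σ {{dense⇒nonZero σ dense}} (dense⇒enough σ dense) ⟩
            E
              ≤⟨ ℕ.m≤m+n E _ ⟩
            E +ₙ E *ₙ 8 *ₙ 0 ∎
          ... | no sparse = begin
            8 *ₙ ∑ edgeDraws (λ es → 𝟙 (¬? (no sparse ×-dec near? σ es)))
              ≤⟨ ℕ.*-monoʳ-≤ 8 (∑-mono (λ es → 𝟙≤1 (¬? (no sparse ×-dec near? σ es))) edgeDraws) ⟩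
            8 *ₙ ∑ edgeDraws (λ _ → 1)
              ≡⟨ cong (8 *ₙ_) (length≡∑1 edgeDraws) ⟨
            8 *ₙ E
              ≡⟨ trans (ℕ.*-comm 8 E) (sym (ℕ.*-identityʳ (E *ₙ 8))) ⟩
            E *ₙ 8 *ₙ 1
              ≤⟨ ℕ.m≤n+m _ E ⟩
            E +ₙ E *ₙ 8 *ₙ 1 ∎

-- Rational arithmetic

/-mono-≤ : ∀ {a b c d} → a *ₙ suc d ≤ₙ c *ₙ suc b → + a / suc b ≤ + c / suc d
/-mono-≤ {a} {b} {c} {d} ad≤cb = ℚ.toℚᵘ-cancel-≤
  (ℚᵘ.≤-respˡ-≃ (ℚᵘ.≃-sym (ℚ.toℚᵘ-fromℚᵘ (mkℚᵘ (+ a) b)))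
  (ℚᵘ.≤-respʳ-≃ (ℚᵘ.≃-sym (ℚ.toℚᵘ-fromℚᵘ (mkℚᵘ (+ c) d)))
  (*≤* (subst₂ ℤ._≤_ (ℤ.pos-* a (suc d)) (ℤ.pos-* c (suc b)) (ℤ.+≤+ ad≤cb)))))

/-cancel-≤ : ∀ {a b c d} → + a / suc b ≤ + c / suc d → a *ₙ suc d ≤ₙ c *ₙ suc b
/-cancel-≤ {a} {b} {c} {d} ab≤cd = ℤ.drop‿+≤+ (subst₂ ℤ._≤_ (sym (ℤ.pos-* a (suc d))) (sym (ℤ.pos-* c (suc b)))
  (ℚᵘ.drop-*≤* {mkℚᵘ (+ a) b} {mkℚᵘ (+ c) d}
  (ℚᵘ.≤-respˡ-≃ (ℚ.toℚᵘ-fromℚᵘ (mkℚᵘ (+ a) b))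
  (ℚᵘ.≤-respʳ-≃ (ℚ.toℚᵘ-fromℚᵘ (mkℚᵘ (+ c) d))
  (ℚ.toℚᵘ-mono-≤ ab≤cd)))))

/-* : ∀ a b c d → + a / suc b * (+ c / suc d) ≡ + (a *ₙ c) / (suc b *ₙ suc d)
/-* a b c d = ℚ.toℚᵘ-injective (begin
  toℚᵘ (+ a / suc b * (+ c / suc d))             ≈⟨ ℚ.toℚᵘ-homo-* (+ a / suc b) (+ c / suc d) ⟩
  toℚᵘ (+ a / suc b) ℚᵘ.* toℚᵘ (+ c / suc d)
    ≈⟨ ℚᵘ.*-cong (ℚ.toℚᵘ-fromℚᵘ (mkℚᵘ (+ a) b)) (ℚ.toℚᵘ-fromℚᵘ (mkℚᵘ (+ c) d)) ⟩
  mkℚᵘ (+ a) b ℚᵘ.* mkℚᵘ (+ c) d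
    ≡⟨ cong (λ z → mkℚᵘ z (d +ₙ b *ₙ suc d)) (sym (ℤ.pos-* a c)) ⟩
  mkℚᵘ (+ (a *ₙ c)) (d +ₙ b *ₙ suc d)            ≈⟨ ℚ.toℚᵘ-fromℚᵘ (mkℚᵘ (+ (a *ₙ c)) (d +ₙ b *ₙ suc d)) ⟨
  toℚᵘ (+ (a *ₙ c) / (suc b *ₙ suc d))           ∎)
  where open ℚᵘ.≃-Reasoning

/-≡ : ∀ {a b c d} → a *ₙ suc d ≡ c *ₙ suc b → + a / suc b ≡ + c / suc d
/-≡ {a} {b} {c} {d} eq = ℚ.≤-antisym (/-mono-≤ {a} {b} {c} {d} (ℕ.≤-reflexive eq)) (/-mono-≤ {c} {d} {a} {b} (ℕ.≤-reflexive (sym eq)))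

fromℕ-mono-≤ : ∀ {a b} → a ≤ₙ b → fromℕ a ≤ fromℕ b
fromℕ-mono-≤ {a} {b} a≤b = /-mono-≤ {a} {0} {b} {0} (ℕ.*-monoˡ-≤ 1 a≤b)

fromℕ-* : ∀ a b → fromℕ (a *ₙ b) ≡ fromℕ a * fromℕ b
fromℕ-* a b = sym (/-* a 0 b 0)

fromℕ-+ : ∀ a b → fromℕ (a +ₙ b) ≡ fromℕ a + fromℕ b
fromℕ-+ a b = ℚ.toℚᵘ-injective (begin
  toℚᵘ (fromℕ (a +ₙ b))                      ≈⟨ ℚ.toℚᵘ-fromℚᵘ (mkℚᵘ (+ (a +ₙ b)) 0) ⟩
  mkℚᵘ (+ a ℤ.+ + b) 0
    ≡⟨ cong₂ (λ x y → mkℚᵘ (x ℤ.+ y) 0) (ℤ.*-identityʳ (+ a)) (ℤ.*-identityʳ (+ b)) ⟨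
  mkℚᵘ (+ a) 0 ℚᵘ.+ mkℚᵘ (+ b) 0
    ≈⟨ ℚᵘ.+-cong (ℚ.toℚᵘ-fromℚᵘ (mkℚᵘ (+ a) 0)) (ℚ.toℚᵘ-fromℚᵘ (mkℚᵘ (+ b) 0)) ⟨
  toℚᵘ (fromℕ a) ℚᵘ.+ toℚᵘ (fromℕ b)         ≈⟨ ℚ.toℚᵘ-homo-+ (fromℕ a) (fromℕ b) ⟨
  toℚᵘ (fromℕ a + fromℕ b)                   ∎)
  where open ℚᵘ.≃-Reasoning

0≤fromℕ : ∀ a → 0ℚ ≤ fromℕ a
0≤fromℕ a = fromℕ-mono-≤ {0} {a} z≤n

fromℕ-positive : ∀ a → Positive (fromℕ (suc a))
fromℕ-positive a = ℚ.normalize-pos (suc a) 1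

ratio-* : ∀ x h → ratio x (suc h) * fromℕ (suc h) ≡ fromℕ x
ratio-* x h = trans (/-* x h (suc h) 0) (/-≡ {x *ₙ suc h} {h *ₙ 1} {x} {0} (regroup x h))
  where
  regroup : ∀ x h → x *ₙ suc h *ₙ 1 ≡ x *ₙ (suc h *ₙ 1)
  regroup = solve-∀

*-mono-≤ : ∀ {p q r s} → 0ℚ ≤ p → p ≤ q → 0ℚ ≤ r → r ≤ s → p * r ≤ q * s
*-mono-≤ {p} {q} {r} {s} 0≤p p≤q 0≤r r≤s = ℚ.≤-trans
  (ℚ.*-monoʳ-≤-nonNeg r {{ℚ.nonNegative 0≤r}} p≤q)
  (ℚ.*-monoˡ-≤-nonNeg q {{ℚ.nonNegative (ℚ.≤-trans 0≤p p≤q)}} r≤s)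

0≤* : ∀ {p q} → 0ℚ ≤ p → 0ℚ ≤ q → 0ℚ ≤ p * q
0≤* {p} {q} 0≤p 0≤q = ℚ.nonNegative⁻¹ (p * q) {{ℚ.nonNeg*nonNeg⇒nonNeg p {{ℚ.nonNegative 0≤p}} q {{ℚ.nonNegative 0≤q}}}}

-- Failures of `P` are among those of the stronger `Q`. For the sampler `Q` is a statement about
-- natural numbers, so rationals enter only through `Q x → P x`.
Pr≥3/4 : {A : Set} (xs : List A) {P Q : A → Set} (P? : Decidable P) (Q? : Decidable Q) →
  (∀ x → Q x → P x) → 0 <ₙ length xs → 4 *ₙ ∑ xs (λ x → 𝟙 (¬? (Q? x))) ≤ₙ length xs →
  + 3 / 4 ≤ Pr xs P?
Pr≥3/4 xs@(_ ∷ ys) P? Q? Q⇒P _ few = /-mono-≤ {3} {3} {length (filter P? xs)} {length ys} (ℕ.+-cancelʳ-≤ L _ _ (begin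
  3 *ₙ L +ₙ L                            ≡⟨ four L ⟩
  4 *ₙ L                                 ≡⟨ cong (4 *ₙ_) (length≡∑1 xs) ⟩
  4 *ₙ ∑ xs (λ _ → 1)                    ≤⟨ ℕ.*-monoʳ-≤ 4 (∑-mono cover xs) ⟩
  4 *ₙ ∑ xs (λ x → 𝟙 (P? x) +ₙ 𝟙 (¬? (Q? x)))
    ≡⟨ cong (4 *ₙ_) (∑-distrib-+ (λ x → 𝟙 (P? x)) (λ x → 𝟙 (¬? (Q? x))) xs) ⟩
  4 *ₙ (∑ xs (λ x → 𝟙 (P? x)) +ₙ bad)      ≡⟨ cong (λ z → 4 *ₙ (z +ₙ bad)) (length-filter P? xs) ⟨
  4 *ₙ (length (filter P? xs) +ₙ bad)      ≡⟨ split (length (filter P? xs)) bad ⟩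
  length (filter P? xs) *ₙ 4 +ₙ 4 *ₙ bad   ≤⟨ ℕ.+-monoʳ-≤ (length (filter P? xs) *ₙ 4) few ⟩
  length (filter P? xs) *ₙ 4 +ₙ L        ∎))
  where
  open ℕ.≤-Reasoning
  L = length xs
  bad = ∑ xs (λ x → 𝟙 (¬? (Q? x)))
  four : ∀ L → 3 *ₙ L +ₙ L ≡ 4 *ₙ L
  four = solve-∀
  split : ∀ p b → 4 *ₙ (p +ₙ b) ≡ p *ₙ 4 +ₙ 4 *ₙ b
  split = solve-∀
  cover : ∀ x → 1 ≤ₙ 𝟙 (P? x) +ₙ 𝟙 (¬? (Q? x))
  cover x with P? x | Q? x
  ... | yes _ | yes _ = s≤s z≤n
  ... | yes _ | no  _ = s≤s z≤n
  ... | no ¬p | yes q = contradiction (Q⇒P x q) ¬p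
  ... | no _  | no  _ = s≤s z≤n

-- The last two hypotheses say `|X − m h| ≤ m h / N`, and `1 / N ≤ ε`. Multiplying by `N h > 0`
-- clears the denominators.
ratio-approximates : ∀ ε N m X h → 1ℚ ≤ fromℕ N * ε → 0 <ₙ X →
  N *ₙ X ≤ₙ N *ₙ (m *ₙ h) +ₙ m *ₙ h → N *ₙ (m *ₙ h) ≤ₙ N *ₙ X +ₙ m *ₙ h →
  Approximates ε m (ratio X h)
ratio-approximates ε zero m X h 1≤Nε _ _ _ = contradiction (subst (1ℚ ≤_) (ℚ.*-zeroˡ ε) 1≤Nε) λ { (ℚ.*≤* (ℤ.+≤+ ())) }
-- Without hits the first bound reads `N X ≤ 0`, so the default value of `ratio` is never the
-- estimate on a good outcome.
ratio-approximates ε N@(suc _) m X@(suc _) zero 1≤Nε _ low _ rewrite ℕ.*-zeroʳ m | ℕ.*-zeroʳ N = contradiction low λ ()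
ratio-approximates ε N@(suc N-1) m X h@(suc h-1) 1≤Nε _ low high =
  ℚ.*-cancelˡ-≤-pos (N̂ * ĥ) {{Nh>0}} lower , ℚ.*-cancelˡ-≤-pos (N̂ * ĥ) {{Nh>0}} upper
  where
  N̂ = fromℕ N
  ĥ = fromℕ h
  m̂ = fromℕ m
  r = ratio X h
  Nh>0 : Positive (N̂ * ĥ)
  Nh>0 = ℚ.pos*pos⇒pos N̂ {{fromℕ-positive N-1}} ĥ {{fromℕ-positive h-1}}
  open ℚ.≤-Reasoning
  open ℚ-Solver.+-*-Solver
  N̂r : N̂ * ĥ * r ≡ fromℕ (N *ₙ X)
  N̂r = trans (ℚ.*-assoc N̂ ĥ r) (trans (cong (N̂ *_) (trans (ℚ.*-comm ĥ r) (ratio-* X h-1))) (sym (fromℕ-* N X)))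
  m̂h : fromℕ (m *ₙ h) ≡ m̂ * ĥ
  m̂h = fromℕ-* m h
  N̂m̂h : fromℕ (N *ₙ (m *ₙ h)) ≡ N̂ * (m̂ * ĥ)
  N̂m̂h = trans (fromℕ-* N (m *ₙ h)) (cong (N̂ *_) m̂h)
  mh≤ : m̂ * ĥ ≤ N̂ * ε * (m̂ * ĥ)
  mh≤ = subst (_≤ N̂ * ε * (m̂ * ĥ)) (ℚ.*-identityˡ (m̂ * ĥ))
    (ℚ.*-monoʳ-≤-nonNeg (m̂ * ĥ) {{ℚ.nonNegative (0≤* (0≤fromℕ m) (0≤fromℕ h))}} 1≤Nε)
  upper : N̂ * ĥ * r ≤ N̂ * ĥ * ((1ℚ + ε) * m̂)
  upper = begin
    N̂ * ĥ * r                               ≡⟨ N̂r ⟩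
    fromℕ (N *ₙ X)                          ≤⟨ fromℕ-mono-≤ low ⟩
    fromℕ (N *ₙ (m *ₙ h) +ₙ m *ₙ h)
      ≡⟨ trans (fromℕ-+ (N *ₙ (m *ₙ h)) (m *ₙ h)) (cong₂ _+_ N̂m̂h m̂h) ⟩
    N̂ * (m̂ * ĥ) + m̂ * ĥ                     ≤⟨ ℚ.+-monoʳ-≤ (N̂ * (m̂ * ĥ)) mh≤ ⟩
    N̂ * (m̂ * ĥ) + N̂ * ε * (m̂ * ĥ)
      ≡⟨ solve 4 (λ N h m ε → N :* (m :* h) :+ N :* ε :* (m :* h) := N :* h :* ((con 1ℚ :+ ε) :* m)) refl N̂ ĥ m̂ ε ⟩
    N̂ * ĥ * ((1ℚ + ε) * m̂)                  ∎
  lower : N̂ * ĥ * ((1ℚ - ε) * m̂) ≤ N̂ * ĥ * r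
  lower = begin
    N̂ * ĥ * ((1ℚ - ε) * m̂)
      ≡⟨ solve 4 (λ N h m ε → N :* h :* ((con 1ℚ :- ε) :* m) := N :* (m :* h) :- N :* ε :* (m :* h)) refl N̂ ĥ m̂ ε ⟩
    N̂ * (m̂ * ĥ) - N̂ * ε * (m̂ * ĥ)           ≤⟨ ℚ.+-monoʳ-≤ (N̂ * (m̂ * ĥ)) (ℚ.neg-antimono-≤ mh≤) ⟩
    N̂ * (m̂ * ĥ) - m̂ * ĥ                     ≡⟨ cong₂ _-_ N̂m̂h m̂h ⟨
    fromℕ (N *ₙ (m *ₙ h)) - fromℕ (m *ₙ h)  ≤⟨ ℚ.+-monoˡ-≤ (ℚ.- fromℕ (m *ₙ h)) (fromℕ-mono-≤ high) ⟩
    fromℕ (N *ₙ X +ₙ m *ₙ h) - fromℕ (m *ₙ h) ≡⟨ cong (_- fromℕ (m *ₙ h)) (fromℕ-+ (N *ₙ X) (m *ₙ h)) ⟩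
    fromℕ (N *ₙ X) + fromℕ (m *ₙ h) - fromℕ (m *ₙ h)
      ≡⟨ solve 2 (λ x y → x :+ y :- y := x) refl (fromℕ (N *ₙ X)) (fromℕ (m *ₙ h)) ⟩
    fromℕ (N *ₙ X)                          ≡⟨ N̂r ⟨
    N̂ * ĥ * r                               ∎

-- The error is given relative to `X` and wanted relative to `Z`. As `N ≥ 1`, the first bound
-- follows from `2 N² ≤ (N + 1)(2 N − 1)` and the second from `X ≤ 2 Z`.
near⇒bounds : ∀ N .{{_ : ℕ.NonZero N}} X Z →
  2 *ₙ N *ₙ X ≤ₙ 2 *ₙ N *ₙ Z +ₙ X → 2 *ₙ N *ₙ Z ≤ₙ 2 *ₙ N *ₙ X +ₙ X →
  N *ₙ X ≤ₙ N *ₙ Z +ₙ Z × N *ₙ Z ≤ₙ N *ₙ X +ₙ Z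
near⇒bounds N@(suc k) X Z low high =
    ℕ.*-cancelˡ-≤ (2 *ₙ N) (ℕ.+-cancelʳ-≤ (suc N *ₙ X) _ _ (begin
      2 *ₙ N *ₙ (N *ₙ X) +ₙ suc N *ₙ X
        ≤⟨ ℕ.+-monoʳ-≤ (2 *ₙ N *ₙ (N *ₙ X)) (ℕ.*-monoˡ-≤ X 1+N≤2N) ⟩
      2 *ₙ N *ₙ (N *ₙ X) +ₙ 2 *ₙ N *ₙ X           ≡⟨ regroup₁ N X ⟩
      suc N *ₙ (2 *ₙ N *ₙ X)                      ≤⟨ ℕ.*-monoʳ-≤ (suc N) low ⟩
      suc N *ₙ (2 *ₙ N *ₙ Z +ₙ X)                 ≡⟨ regroup₂ N Z X ⟩
      2 *ₙ N *ₙ (N *ₙ Z +ₙ Z) +ₙ suc N *ₙ X       ∎))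
  , ℕ.*-cancelˡ-≤ (2 *ₙ N) (begin
      2 *ₙ N *ₙ (N *ₙ Z)                          ≡⟨ regroup₃ N Z ⟩
      N *ₙ (2 *ₙ N *ₙ Z)                          ≤⟨ ℕ.*-monoʳ-≤ N high ⟩
      N *ₙ (2 *ₙ N *ₙ X +ₙ X)                     ≡⟨ ℕ.*-distribˡ-+ N (2 *ₙ N *ₙ X) X ⟩
      N *ₙ (2 *ₙ N *ₙ X) +ₙ N *ₙ X                ≤⟨ ℕ.+-monoʳ-≤ (N *ₙ (2 *ₙ N *ₙ X)) NX≤2NZ ⟩
      N *ₙ (2 *ₙ N *ₙ X) +ₙ 2 *ₙ N *ₙ Z           ≡⟨ regroup₄ N X Z ⟩
      2 *ₙ N *ₙ (N *ₙ X +ₙ Z)                     ∎)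
  where
  open ℕ.≤-Reasoning
  1+N≤2N : suc N ≤ₙ 2 *ₙ N
  1+N≤2N = subst (suc N ≤ₙ_) (cong (N +ₙ_) (sym (ℕ.+-identityʳ N))) (ℕ.+-monoˡ-≤ N (s≤s (z≤n {k})))
  NX≤2NZ : N *ₙ X ≤ₙ 2 *ₙ N *ₙ Z
  NX≤2NZ = ℕ.+-cancelʳ-≤ X _ _ (begin
    N *ₙ X +ₙ X             ≡⟨ ℕ.+-comm (N *ₙ X) X ⟩
    suc N *ₙ X              ≤⟨ ℕ.*-monoˡ-≤ X 1+N≤2N ⟩
    2 *ₙ N *ₙ X             ≤⟨ low ⟩
    2 *ₙ N *ₙ Z +ₙ X        ∎)
  regroup₁ : ∀ N X → 2 *ₙ N *ₙ (N *ₙ X) +ₙ 2 *ₙ N *ₙ X ≡ suc N *ₙ (2 *ₙ N *ₙ X)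
  regroup₁ = solve-∀
  regroup₂ : ∀ N Z X → suc N *ₙ (2 *ₙ N *ₙ Z +ₙ X) ≡ 2 *ₙ N *ₙ (N *ₙ Z +ₙ Z) +ₙ suc N *ₙ X
  regroup₂ = solve-∀
  regroup₃ : ∀ N Z → 2 *ₙ N *ₙ (N *ₙ Z) ≡ N *ₙ (2 *ₙ N *ₙ Z)
  regroup₃ = solve-∀
  regroup₄ : ∀ N X Z → N *ₙ (2 *ₙ N *ₙ X) +ₙ 2 *ₙ N *ₙ Z ≡ 2 *ₙ N *ₙ (N *ₙ X +ₙ Z)
  regroup₄ = solve-∀

-- For positive `ε` this is `⌊1/ε⌋ + 1`: at least `1/ε`, and at most `2/ε` when `ε < 1`.
precision : ℚ → ℕ
precision (mkℚ +[1+ p ] d-1 _) = suc (suc d-1 ℕ./ suc p)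
precision _                    = 1

precision-nonZero : ∀ ε → ℕ.NonZero (precision ε)
precision-nonZero (mkℚ +[1+ _ ] _ _) = _
precision-nonZero (mkℚ (+ 0)    _ _) = _
precision-nonZero (mkℚ -[1+ _ ] _ _) = _

private
  as-fraction : ∀ ε → ε ≡ ℚ.↥ ε / ℚ.↧ₙ ε
  as-fraction ε@record{} = sym (ℚ.fromℚᵘ-toℚᵘ ε)

  1≤-fraction : ∀ {x d-1} → suc d-1 ≤ₙ x → 1ℚ ≤ + x / suc d-1
  1≤-fraction {x} {d-1} d≤x = /-mono-≤ {1} {0} {x} {d-1} (subst₂ _≤ₙ_ (sym (ℕ.+-identityʳ (suc d-1))) (sym (ℕ.*-identityʳ x)) d≤x)

  fromℕ-*-fraction : ∀ a x d-1 → fromℕ a * (+ x / suc d-1) ≡ + (a *ₙ x) / suc d-1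
  fromℕ-*-fraction a x d-1 = trans (/-* a 0 x d-1) (/-≡ {a *ₙ x} {d-1 +ₙ 0} {a *ₙ x} {d-1} (cong (λ z → a *ₙ x *ₙ suc z) (sym (ℕ.+-identityʳ d-1))))

precision-lower : ∀ ε .{{_ : Positive ε}} → 1ℚ ≤ fromℕ (precision ε) * ε
precision-lower ε@(mkℚ +[1+ p ] d-1 _) = subst (1ℚ ≤_)
  (sym (trans (cong (fromℕ (precision ε) *_) (as-fraction ε)) (fromℕ-*-fraction (precision ε) (suc p) d-1)))
  (1≤-fraction {precision ε *ₙ suc p} (begin
    suc d-1                                                     ≡⟨ ℕ.m≡m%n+[m/n]*n (suc d-1) (suc p) ⟩
    suc d-1 ℕ.% suc p +ₙ suc d-1 ℕ./ suc p *ₙ suc p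
      ≤⟨ ℕ.+-monoˡ-≤ _ (ℕ.<⇒≤ (ℕ.m%n<n (suc d-1) (suc p))) ⟩
    precision ε *ₙ suc p                                        ∎))
  where open ℕ.≤-Reasoning

recip-fraction : ∀ ε .{{_ : Positive ε}} .{{_ : ℕ.NonZero ℤ.∣ ℚ.↥ ε ∣}} → recip ε ≡ + ℚ.↧ₙ ε / ℤ.∣ ℚ.↥ ε ∣
recip-fraction ε@(mkℚ +[1+ p ] d-1 _) = as-fraction (recip ε)

numerator≤denominator : ∀ ε .{{_ : Positive ε}} → ¬ 1ℚ ≤ ε → ℤ.∣ ℚ.↥ ε ∣ ≤ₙ ℚ.↧ₙ ε
numerator≤denominator ε@(mkℚ +[1+ p ] d-1 _) ε≱1 =
  ℕ.<⇒≤ (ℕ.≰⇒> λ d≤p → ε≱1 (subst (1ℚ ≤_) (sym (as-fraction ε)) (1≤-fraction d≤p)))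

1≤recip : ∀ ε .{{_ : Positive ε}} → ¬ 1ℚ ≤ ε → 1ℚ ≤ recip ε
1≤recip ε@(mkℚ +[1+ p ] d-1 _) ε≱1 = subst (1ℚ ≤_) (sym (recip-fraction ε)) (1≤-fraction (numerator≤denominator ε ε≱1))

precision-upper : ∀ ε .{{_ : Positive ε}} → ¬ 1ℚ ≤ ε → fromℕ (precision ε) ≤ fromℕ 2 * recip ε
precision-upper ε@(mkℚ +[1+ p ] d-1 _) ε≱1 = subst (fromℕ (precision ε) ≤_)
  (sym (trans (cong (fromℕ 2 *_) (recip-fraction ε)) (fromℕ-*-fraction 2 (suc d-1) p)))
  (/-mono-≤ {precision ε} {0} {2 *ₙ suc d-1} {p} (begin
    precision ε *ₙ suc p
      ≤⟨ ℕ.+-mono-≤ (numerator≤denominator ε ε≱1) (ℕ.m/n*n≤m (suc d-1) (suc p)) ⟩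
    suc d-1 +ₙ suc d-1                            ≡⟨ double (suc d-1) ⟩
    2 *ₙ suc d-1 *ₙ 1                             ∎))
  where
  open ℕ.≤-Reasoning
  double : ∀ d → d +ₙ d ≡ 2 *ₙ d *ₙ 1
  double = solve-∀

-- Choice of parameters

scaled-sqrt : ∀ K .{{_ : ℕ.NonZero K}} n → ∃[ a ] (K *ₙ (a *ₙ a) ≤ₙ n × n <ₙ K *ₙ (suc a *ₙ suc a))
scaled-sqrt K zero    = 0 , ℕ.≤-reflexive (ℕ.*-zeroʳ K) , subst (0 <ₙ_) (sym (ℕ.*-identityʳ K)) (ℕ.>-nonZero⁻¹ K)
scaled-sqrt K (suc n) with scaled-sqrt K n
... | a , lo , hi with suc n ℕ.<? K *ₙ (suc a *ₙ suc a)
...   | yes below = a , ℕ.m≤n⇒m≤1+n lo , below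
...   | no  above = suc a , ℕ.≮⇒≥ above , ℕ.≤-<-trans hi (ℕ.*-monoʳ-< K (ℕ.*-mono-< (ℕ.n<1+n (suc a)) (ℕ.n<1+n (suc a))))

-- For `a ≥ 1` it suffices that `a + 1 ≤ 2 a`; for `a = 0` the positivity of `suc n` is what counts.
suc²≤4n : ∀ K .{{_ : ℕ.NonZero K}} n a → K *ₙ (a *ₙ a) ≤ₙ suc n → suc a *ₙ suc a ≤ₙ 4 *ₙ suc n
suc²≤4n K n zero    _  = s≤s z≤n
suc²≤4n K n (suc a) lo = begin
  suc (suc a) *ₙ suc (suc a)                ≤⟨ ℕ.*-mono-≤ bound bound ⟩
  2 *ₙ suc a *ₙ (2 *ₙ suc a)                ≡⟨ regroup (suc a) ⟩
  4 *ₙ (suc a *ₙ suc a)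
    ≤⟨ ℕ.*-monoʳ-≤ 4 (ℕ.≤-trans (ℕ.m≤n*m (suc a *ₙ suc a) K) lo) ⟩
  4 *ₙ suc n                                ∎
  where
  open ℕ.≤-Reasoning
  bound : suc (suc a) ≤ₙ 2 *ₙ suc a
  bound = subst (suc (suc a) ≤ₙ_) (cong (suc a +ₙ_) (sym (ℕ.+-identityʳ (suc a)))) (s≤s (ℕ.m≤n+m (suc a) a))
  regroup : ∀ b → 2 *ₙ b *ₙ (2 *ₙ b) ≡ 4 *ₙ (b *ₙ b)
  regroup = solve-∀

abstract
  -- K = 256², so that t = 64 a satisfies 8 t² ≤ m as soon as K a² ≤ n ≤ 2 m; abstract lest the numeral be unfolded.
  K : ℕ
  K = 65536

  K≡16·64² : K ≡ 16 *ₙ (64 *ₙ 64)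
  K≡16·64² = refl

  instance
    K-nonZero : ℕ.NonZero K
    K-nonZero = _

module Parameters (n N : ℕ) where
  a = proj₁ (scaled-sqrt K n)
  b = suc a
  -- `s b = K b²` exceeds `n` by the choice of `a`, so there is room for all vertices, with `c`
  -- blanks left over.
  s = K *ₙ b
  -- 256 is 64 from `few-far` times 4 from `Dense`.
  q = 256 *ₙ (N *ₙ N *ₙ b)
  c = s *ₙ b ℕ.∸ n

  lower : K *ₙ (a *ₙ a) ≤ₙ n
  lower = proj₁ (proj₂ (scaled-sqrt K n))

  cover : s *ₙ b ≡ n +ₙ c
  cover = sym (ℕ.m+[n∸m]≡n (ℕ.<⇒≤ (subst (n <ₙ_) (sym (ℕ.*-assoc K b b)) (proj₂ (proj₂ (scaled-sqrt K n))))))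

  open Sampler n s a q c cover public

-- The algorithm, with its trivial cases

idle : ∀ {n} → NonAdaptive n
idle = record
  { seeds      = 1
  ; queryCount = 0
  ; query      = λ _ ()
  ; estimate   = λ _ _ → 0ℚ
  }

idle-succeeds : ∀ {n} ε (G : Graph n) → Approximates ε (∣E∣ G) 0ℚ → + 3 / 4 ≤ successProbability idle G ε
idle-succeeds ε G ok = Pr≥3/4 (outcomes idle G) {Q = λ _ → ⊤}
  (λ x → approximates? ε (∣E∣ G) (output idle G x)) (λ _ → yes _) (λ _ _ → ok) (s≤s z≤n) z≤n

1≤⇒approximates-0 : ∀ ε m → 1ℚ ≤ ε → Approximates ε m 0ℚ
1≤⇒approximates-0 ε m 1≤ε =
    ℚ.≤-trans (ℚ.*-monoʳ-≤-nonNeg (fromℕ m) {{m≥0}} (subst (1ℚ - ε ≤_) (ℚ.+-inverseʳ ε) (ℚ.+-monoˡ-≤ (ℚ.- ε) 1≤ε)))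
              (ℚ.≤-reflexive (ℚ.*-zeroˡ (fromℕ m)))
  , 0≤* (ℚ.≤-trans (0≤fromℕ 2) (ℚ.+-monoʳ-≤ 1ℚ 1≤ε)) (0≤fromℕ m)
  where
  m≥0 : NonNegative (fromℕ m)
  m≥0 = ℚ.nonNegative (0≤fromℕ m)

approximates-0-0 : ∀ ε → Approximates ε 0 0ℚ
approximates-0-0 ε = ℚ.≤-reflexive (ℚ.*-zeroʳ (1ℚ - ε)) , ℚ.≤-reflexive (sym (ℚ.*-zeroʳ (1ℚ + ε)))

-- For `ε ≥ 1` the estimate 0 is acceptable, and a positive number of queries would break the bound
-- for large `ε`, since `recip ε ^ 5` tends to 0. The decision is an argument so that later proofs
-- can match on it.
choose : ∀ n (ε : ℚ) → Dec (1ℚ ≤ ε) → NonAdaptive (suc n)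
choose n ε (yes _) = idle
choose n ε (no  _) = Parameters.sampler (suc n) (precision ε)

algorithm : Algorithm
-- Without vertices the query bound is 0, and any query at all would leave an empty list of
-- outcomes, as there is no edge to draw.
algorithm zero    ε = idle
algorithm (suc n) ε = choose n ε (1ℚ ℚ.≤? ε)

-- Success probability

n≤2∣E∣ : ∀ {n m} → + n / 2 ≤ fromℕ m → n ≤ₙ m *ₙ 2
n≤2∣E∣ {n} {m} n/2≤m = subst (_≤ₙ m *ₙ 2) (ℕ.*-identityʳ n) (/-cancel-≤ {n} {1} {m} {0} n/2≤m)

-- The constants are variables tied by `k ≡ 16 t²`, which keeps the numeral `K` out of the ring
-- solver. Here 16 is 8 from the threshold for heavy vertices times 2 from `n ≤ 2 m`.
light-threshold : ∀ k t a n m → k ≡ 16 *ₙ (t *ₙ t) → k *ₙ (a *ₙ a) ≤ₙ n → n ≤ₙ m *ₙ 2 → 8 *ₙ (t *ₙ a *ₙ (t *ₙ a)) ≤ₙ m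
light-threshold _ t a n m refl lower n≤2m = ℕ.*-cancelʳ-≤ _ m 2 (begin
  8 *ₙ (t *ₙ a *ₙ (t *ₙ a)) *ₙ 2      ≡⟨ regroup t a ⟩
  16 *ₙ (t *ₙ t) *ₙ (a *ₙ a)          ≤⟨ lower ⟩
  n                                   ≤⟨ n≤2m ⟩
  m *ₙ 2                              ∎)
  where
  open ℕ.≤-Reasoning
  regroup : ∀ t a → 8 *ₙ (t *ₙ a *ₙ (t *ₙ a)) *ₙ 2 ≡ 16 *ₙ (t *ₙ t) *ₙ (a *ₙ a)
  regroup = solve-∀

sampler-succeeds : ∀ n ε .{{_ : Positive ε}} (G : Graph (suc n)) → suc n ≤ₙ ∣E∣ G *ₙ 2 →
  + 3 / 4 ≤ successProbability (Parameters.sampler (suc n) (precision ε)) G ε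
sampler-succeeds n ε G n≤2m = Pr≥3/4 (outcomes sampler G)
  (λ x → approximates? ε m (output sampler G x)) good? good⇒approximates nonEmpty (few-bad ℕ.≤-refl threshold)
  where
  N = precision ε
  m = ∣E∣ G
  open Parameters (suc n) N
  open Analysis G
  open Accuracy N
  instance
    N≢0 : ℕ.NonZero N
    N≢0 = precision-nonZero ε
    m≢0 : ℕ.NonZero m
    m≢0 = ℕ.>-nonZero (ℕ.*-cancelʳ-< 2 0 m (ℕ.<-≤-trans (s≤s z≤n) n≤2m))
  threshold : 8 *ₙ (64 *ₙ a *ₙ (64 *ₙ a)) ≤ₙ m
  threshold = light-threshold K 64 a (suc n) m K≡16·64² lower n≤2m
  -- An empty list of outcomes has probability 0 by definition, so `m ≥ 1` is essential here.
  nonEmpty : 0 <ₙ length (outcomes sampler G)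
  nonEmpty = subst (0 <ₙ_) (sym (length-cartesianProductWith _,_ (allFin (length samples)) edgeDraws))
    (ℕ.*-mono-< (subst (0 <ₙ_) (sym (length-allFin (length samples))) (draws-nonEmpty (allFin b) (allFin-nonEmpty a) s))
                (draws-nonEmpty (edges G) (ℕ.>-nonZero⁻¹ m) (s +ₙ q)))
  good⇒approximates : ∀ x → Good x → Approximates ε m (output sampler G x)
  good⇒approximates (ω , es) (dense , low , high) = subst (Approximates ε m) (sym (output≡ ω es))
    (ratio-approximates ε N m X H (precision-lower ε) (ℕ.>-nonZero⁻¹ X {{dense⇒nonZero ℕ.≤-refl σ dense}})
      (proj₁ bounds) (proj₂ bounds))
    where
    σ = lookup samples ω
    X = q *ₙ degreeSum σ
    H = hitSum σ es
    bounds = near⇒bounds N X (m *ₙ H) low high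

-- Number of queries

queryCount-bound : ∀ κ Q N b n x → Q ≤ₙ κ *ₙ (N *ₙ N *ₙ b) → b *ₙ b ≤ₙ 4 *ₙ n → 1ℚ ≤ x → fromℕ N ≤ fromℕ 2 * x →
  fromℕ Q ^ 2 ≤ fromℕ (8 *ₙ κ) ^ 2 * (fromℕ n * x ^ 5)
queryCount-bound κ Q N b n x Q≤ b²≤4n 1≤x N≤2x = begin
  fromℕ Q * (fromℕ Q * 1ℚ)
    ≡⟨ trans (cong (fromℕ Q *_) (ℚ.*-identityʳ (fromℕ Q))) (sym (fromℕ-* Q Q)) ⟩
  fromℕ (Q *ₙ Q)
    ≤⟨ fromℕ-mono-≤ Q²≤ ⟩
  fromℕ (κ *ₙ κ *ₙ (4 *ₙ n) *ₙ (N *ₙ N *ₙ (N *ₙ N)))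
    ≡⟨ trans (fromℕ-* (κ *ₙ κ *ₙ (4 *ₙ n)) _) (cong₂ _*_ (trans (fromℕ-* (κ *ₙ κ) (4 *ₙ n)) (cong₂ _*_ (fromℕ-* κ κ) (fromℕ-* 4 n)))
        (trans (fromℕ-* (N *ₙ N) (N *ₙ N)) (cong₂ _*_ (fromℕ-* N N) (fromℕ-* N N)))) ⟩
  κ̂ * κ̂ * (fromℕ 4 * n̂) * (N̂ * N̂ * (N̂ * N̂))
    ≤⟨ *-mono-≤ κκ4n≥0 ℚ.≤-refl (0≤* NN≥0 NN≥0) (*-mono-≤ NN≥0 NN≤ NN≥0 NN≤) ⟩
  κ̂ * κ̂ * (fromℕ 4 * n̂) * (fromℕ 2 * x * (fromℕ 2 * x) * (fromℕ 2 * x * (fromℕ 2 * x)))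
    ≡⟨ solve 3 (λ κ n x → κ :* κ :* (con (fromℕ 4) :* n) :* (con (fromℕ 2) :* x :* (con (fromℕ 2) :* x) :* (con (fromℕ 2) :* x :* (con (fromℕ 2) :* x)))
         := con (fromℕ 64) :* κ :* κ :* n :* (x :* x :* (x :* x)) :* con 1ℚ) refl κ̂ n̂ x ⟩
  fromℕ 64 * κ̂ * κ̂ * n̂ * (x * x * (x * x)) * 1ℚ
    -- So far the bound is `64 κ² n x⁴`, that is `8 κ √n / ε²` queries when `x = 1/ε`; the factor
    -- `1 ≤ x` pads it to the exponent 5 of the claim.
    ≤⟨ *-mono-≤ (0≤* (0≤* (0≤* (0≤* (0≤fromℕ 64) (0≤fromℕ κ)) (0≤fromℕ κ)) (0≤fromℕ n)) (0≤* (0≤* x≥0 x≥0) (0≤* x≥0 x≥0))) ℚ.≤-refl (0≤fromℕ 1) 1≤x ⟩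
  fromℕ 64 * κ̂ * κ̂ * n̂ * (x * x * (x * x)) * x
    ≡⟨ solve 3 (λ κ n x → con (fromℕ 64) :* κ :* κ :* n :* (x :* x :* (x :* x)) :* x
         := con (fromℕ 8) :* κ :* (con (fromℕ 8) :* κ :* con 1ℚ) :* (n :* (x :* (x :* (x :* (x :* (x :* con 1ℚ))))))) refl κ̂ n̂ x ⟩
  fromℕ 8 * κ̂ * (fromℕ 8 * κ̂ * 1ℚ) * (n̂ * x ^ 5)
    ≡⟨ cong (λ z → z * (z * 1ℚ) * (n̂ * x ^ 5)) (fromℕ-* 8 κ) ⟨
  fromℕ (8 *ₙ κ) ^ 2 * (n̂ * x ^ 5) ∎
  where
  open ℚ.≤-Reasoning
  open ℚ-Solver.+-*-Solver using (solve; con; _:*_; _:=_)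
  κ̂ = fromℕ κ
  n̂ = fromℕ n
  N̂ = fromℕ N
  x≥0 : 0ℚ ≤ x
  x≥0 = ℚ.≤-trans (0≤fromℕ 1) 1≤x
  NN≥0 : 0ℚ ≤ N̂ * N̂
  NN≥0 = 0≤* (0≤fromℕ N) (0≤fromℕ N)
  NN≤ : N̂ * N̂ ≤ fromℕ 2 * x * (fromℕ 2 * x)
  NN≤ = *-mono-≤ (0≤fromℕ N) N≤2x (0≤fromℕ N) N≤2x
  κκ4n≥0 : 0ℚ ≤ κ̂ * κ̂ * (fromℕ 4 * n̂)
  κκ4n≥0 = 0≤* (0≤* (0≤fromℕ κ) (0≤fromℕ κ)) (0≤* (0≤fromℕ 4) (0≤fromℕ n))
  Q²≤ : Q *ₙ Q ≤ₙ κ *ₙ κ *ₙ (4 *ₙ n) *ₙ (N *ₙ N *ₙ (N *ₙ N))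
  Q²≤ = ℕR.begin
    Q *ₙ Q                                                ℕR.≤⟨ ℕ.*-mono-≤ Q≤ Q≤ ⟩
    κ *ₙ (N *ₙ N *ₙ b) *ₙ (κ *ₙ (N *ₙ N *ₙ b))            ℕR.≡⟨ regroup κ N b ⟩
    κ *ₙ κ *ₙ (b *ₙ b) *ₙ (N *ₙ N *ₙ (N *ₙ N))
      ℕR.≤⟨ ℕ.*-monoˡ-≤ (N *ₙ N *ₙ (N *ₙ N)) (ℕ.*-monoʳ-≤ (κ *ₙ κ) b²≤4n) ⟩
    κ *ₙ κ *ₙ (4 *ₙ n) *ₙ (N *ₙ N *ₙ (N *ₙ N))            ℕR.∎
    where
    module ℕR = ℕ.≤-Reasoning
    regroup : ∀ κ N b → κ *ₙ (N *ₙ N *ₙ b) *ₙ (κ *ₙ (N *ₙ N *ₙ b)) ≡ κ *ₙ κ *ₙ (b *ₙ b) *ₙ (N *ₙ N *ₙ (N *ₙ N))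
    regroup = solve-∀

bound-nonNegative : ∀ C n x → 0ℚ ≤ x → fromℕ 0 ^ 2 ≤ fromℕ C ^ 2 * (fromℕ n * x ^ 5)
bound-nonNegative C n x x≥0 = 0≤* (power≥0 (0≤fromℕ C) 2) (0≤* (0≤fromℕ n) (power≥0 x≥0 5))
  where
  power≥0 : ∀ {y} → 0ℚ ≤ y → ∀ k → 0ℚ ≤ y ^ k
  power≥0 y≥0 zero    = 0≤fromℕ 1
  power≥0 y≥0 (suc k) = 0≤* y≥0 (power≥0 y≥0 k)

recip≥0 : ∀ ε .{{_ : Positive ε}} → 0ℚ ≤ recip ε
recip≥0 ε@(mkℚ +[1+ p ] d-1 _) = ℚ.nonNegative⁻¹ (recip ε)

sampler-queries : ∀ n ε .{{_ : Positive ε}} → ¬ 1ℚ ≤ ε →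
  fromℕ (NonAdaptive.queryCount (Parameters.sampler (suc n) (precision ε))) ^ 2
    ≤ fromℕ (8 *ₙ (K +ₙ 256)) ^ 2 * (fromℕ (suc n) * recip ε ^ 5)
sampler-queries n ε ε≱1 = queryCount-bound (K +ₙ 256) (s +ₙ q) N b (suc n) (recip ε) Q≤
  (suc²≤4n K n a lower) (1≤recip ε ε≱1) (precision-upper ε ε≱1)
  where
  N = precision ε
  open Parameters (suc n) N
  instance
    N≢0 : ℕ.NonZero N
    N≢0 = precision-nonZero ε
  Q≤ : s +ₙ q ≤ₙ (K +ₙ 256) *ₙ (N *ₙ N *ₙ b)
  Q≤ = begin
    K *ₙ b +ₙ q
      -- `N ≥ 1` lets the `K b` vertex probes share the factor `N² b` of the edge queries.
      ≤⟨ ℕ.+-monoˡ-≤ q (ℕ.*-monoʳ-≤ K (ℕ.m≤n*m b (N *ₙ N) {{ℕ.m*n≢0 N N}})) ⟩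
    K *ₙ (N *ₙ N *ₙ b) +ₙ q          ≡⟨ ℕ.*-distribʳ-+ (N *ₙ N *ₙ b) K 256 ⟨
    (K +ₙ 256) *ₙ (N *ₙ N *ₙ b)      ∎
    where open ℕ.≤-Reasoning

queryFactor : ℕ
queryFactor = 8 *ₙ (K +ₙ 256)

choose-queries : ∀ n ε .{{_ : Positive ε}} (1≤ε? : Dec (1ℚ ≤ ε)) →
  fromℕ (NonAdaptive.queryCount (choose n ε 1≤ε?)) ^ 2 ≤ fromℕ queryFactor ^ 2 * (fromℕ (suc n) * recip ε ^ 5)
choose-queries n ε (yes _)  = bound-nonNegative queryFactor (suc n) (recip ε) (recip≥0 ε)
choose-queries n ε (no ε≱1) = sampler-queries n ε ε≱1

choose-succeeds : ∀ n ε .{{_ : Positive ε}} (1≤ε? : Dec (1ℚ ≤ ε)) (G : Graph (suc n)) →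
  + suc n / 2 ≤ fromℕ (∣E∣ G) → + 3 / 4 ≤ successProbability (choose n ε 1≤ε?) G ε
choose-succeeds n ε (yes 1≤ε) G _     = idle-succeeds ε G (1≤⇒approximates-0 ε (∣E∣ G) 1≤ε)
choose-succeeds n ε (no _)    G n/2≤m = sampler-succeeds n ε G (n≤2∣E∣ {suc n} {∣E∣ G} n/2≤m)

algorithm-queries : ∀ n ε .{{_ : Positive ε}} →
  fromℕ (NonAdaptive.queryCount (algorithm n ε)) ^ 2 ≤ fromℕ queryFactor ^ 2 * (fromℕ n * recip ε ^ 5)
algorithm-queries zero    ε = bound-nonNegative queryFactor 0 (recip ε) (recip≥0 ε)
algorithm-queries (suc n) ε = choose-queries n ε (1ℚ ℚ.≤? ε)

algorithm-succeeds : ∀ n ε .{{_ : Positive ε}} (G : Graph n) →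
  + n / 2 ≤ fromℕ (∣E∣ G) → + 3 / 4 ≤ successProbability (algorithm n ε) G ε
algorithm-succeeds zero    ε G _ = idle-succeeds ε G (approximates-0-0 ε)
algorithm-succeeds (suc n) ε G   = choose-succeeds n ε (1ℚ ℚ.≤? ε) G

theorem1 : Σ[ A ∈ Algorithm ]
    ((λ n ε → NonAdaptive.queryCount (A n ε)) ∈Õ√ (λ n ε → fromℕ n * recip ε ^ 5))
    × (∀ (n : ℕ) (ε : ℚ) .{{_ : Positive ε}} (G : Graph n) →
    (+ n / 2) ≤ fromℕ (∣E∣ G) →
    (+ 3 / 4) ≤ successProbability (A n ε) G ε)
-- The exponent 0 of `logFactor` records that no logarithmic factor is lost.
theorem1 = algorithm , (queryFactor , 0 , queries) , algorithm-succeeds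
  where
  queries : ∀ n ε .{{_ : Positive ε}} →
    fromℕ (NonAdaptive.queryCount (algorithm n ε)) ^ 2
      ≤ fromℕ (queryFactor *ₙ logFactor n ε ℕ.^ 0) ^ 2 * (fromℕ n * recip ε ^ 5)
  queries n ε = subst (λ c → fromℕ (NonAdaptive.queryCount (algorithm n ε)) ^ 2 ≤ fromℕ c ^ 2 * (fromℕ n * recip ε ^ 5))
    (sym (ℕ.*-identityʳ queryFactor)) (algorithm-queries n ε)
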